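{- Let $(X,d)$ be a Robinson space, $p$ a point of $X$, and $S\subseteq X$ with $p\in S$. Let $\prec$ be a universal $p$-proximity order. Then there is a standard node $\alpha\in\Upsilon(p)$ with $X(\alpha)=S$ if and only if there exists a frontier $C\in\mathcal C_p$ with $[C_0,C]=S$.
   Context: A dissimilarity on a finite set $X$ is a symmetric function $d:X^2\to\mathbb R_{\ge 0}$ with $d(x,y)=0$ if $x=y$. A total order $<$ on $X$ is compatible if $x<y<z$ implies $d(x,z)\ge\max\{d(x,y),d(y,z)\}$. $(X,d)$ is Robinson if it admits a compatible order. A PQ-tree over $X$ is an ordered rooted tree whose leaves are identified with the elements of $X$, whose inner nodes have at least 2 children and are each labelled P-node or Q-node; nodes with exactly 2 children are considered P-nodes. Two PQ-trees are equivalent if one is obtained from the other by a sequence of: arbitrarily permuting the children of a P-node; reversing the order of the children of a Q-node. The PQ-tree represents the set of left-to-right leaf orders of all equivalent PQ-trees. The PQ-tree of a Robinson space is the PQ-tree (unique up to equivalence) representing exactly the set of its compatible orders. $X(\alpha)$ is the set of leaves below node $\alpha$ (with $X(x)=\{x\}$ for a leaf $x$). $\Upsilon(p)$ is the path of the PQ-tree of $(X,d)$ between the leaf $p$ and the root (both included). For $\delta>0$, $G_{\overline\delta}(S)$ is the graph on $S\subseteq X$ with edges $\{xy:x\ne y,\ d(x,y)\ne\delta\}$. A Q-node $\alpha$ with children $\beta_1,\dots,\beta_k$ is $\delta$-conical if it has a child $\beta_i$ (then unique, called the apex child) such that for all $j\ne i$, $d(x,y)=\delta$ for all $x\in X(\beta_i),y\in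 X(\beta_j)$. A node $\alpha$ is split if, for some $\delta>0$, it is the apex child of a $\delta$-conical Q-node and $G_{\overline\delta}(X(\alpha))$ is not connected; otherwise it is standard. An mmodule is a set $M\subseteq X$ such that $d(z,x)=d(z,y)$ for all $z\in X\setminus M$ and $x,y\in M$. A $p$-copoint is an inclusion-maximal mmodule among those not containing $p$. $\mathcal C_p$ is the set consisting of $C_0=\{p\}$ and all $p$-copoints; it is a partition of $X$. For $C\in\mathcal C_p$, $d(C,p)$ is the common value of $d(x,p)$, $x\in C$. A $p$-proximity order relative to a compatible order $<$ is a total order $\prec$ on $\mathcal C_p$ such that $C\prec C'$ implies: (PO1) $d(C,p)\le d(C',p)$; (PO2) when $X$ is sorted by $<$, no point of $C'$ is located between $p$ and a point of $C$. It is universal if it is a $p$-proximity order relative to every compatible order of $(X,d)$. The members of $\mathcal C_p$ are ordered as $\{p\}=C_0\prec C_1\prec\dots\prec C_k$, and $[C_0,C_i]:=C_0\cup\dots\cup C_i$. $C\in\mathcal C_p$ is a frontier if $[C_0,C]$ is an mmodule.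
   Formalization: Proved under the added assumption that no node on Υ(p) satisfies the split condition with δ=0 (automatic if distinct points have positive distance); otherwise such a node counts as standard but corresponds to no frontier, and the claim fails. -}

module Defs where

open import Level using (Level; 0ℓ; _⊔_) renaming (suc to lsuc)
open import Data.Nat using (ℕ; _≤_)
open import Data.Fin using (Fin)
open import Data.Fin.Subset using (Subset; ⁅_⁆; Nonempty; _⊆_; _∈_; _∉_)
open import Data.List using (List; []; _∷_; _++_; length; lookup; reverse; allFin)
import Data.List.Membership.Propositional as List∈
open import Data.List.Relation.Unary.All using (All)
open import Data.List.Relation.Unary.AllPairs using (AllPairs)
open import Data.List.Relation.Binary.Permutation.Propositional using (_↭_)
open import Data.Product using (Σ; Σ-syntax; ∃-syntax; _×_; _,_; proj₁)
open import Data.Sum using (_⊎_; inj₁)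
open import Function using (_on_)
open import Function.Bundles using (_⇔_)
open import Relation.Nullary using (¬_)
open import Relation.Unary using (Pred)
open import Relation.Binary using (Rel; DecTotalOrder; IsStrictTotalOrder; Minimum)
open import Relation.Binary.PropositionalEquality using (_≡_; _≢_; refl)
open import Relation.Binary.Construct.Closure.ReflexiveTransitive using (Star)
import Relation.Binary.Properties.DecTotalOrder as DecTotalOrderProperties

-- Dissimilarities take values in ℝ≥0, of which only the total order and its
-- least element 0 are ever used.  The reals are not available, so the value
-- domain is an arbitrary total order (with decidable order, as classical ℝ≥0
-- has) with a least element.
record Values (c ℓ₁ ℓ₂ : Level) : Set (lsuc (c ⊔ ℓ₁ ⊔ ℓ₂)) where
  field
    decTotalOrder : DecTotalOrder c ℓ₁ ℓ₂
  open DecTotalOrder decTotalOrder public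
    using (_≈_) renaming (Carrier to Value; _≤_ to _≤ᵥ_)
  open DecTotalOrderProperties decTotalOrder public
    using () renaming (_<_ to _<ᵥ_)
  field
    0#      : Value
    minimum : Minimum _≤ᵥ_ 0#

-- The finite set X is Fin n.
record Dissimilarity {c ℓ₁ ℓ₂ : Level} (V : Values c ℓ₁ ℓ₂) (n : ℕ)
    : Set (c ⊔ ℓ₁ ⊔ ℓ₂) where
  open Values V
  field
    dist : Fin n → Fin n → Value
    symm : ∀ x y → dist x y ≈ dist y x
    diag : ∀ x → dist x x ≈ 0#

data Label : Set where
  P Q : Label

data Tree (n : ℕ) : Set where
  leaf : Fin n → Tree n
  node : Label → List (Tree n) → Tree n

leaves  : ∀ {n} → Tree n → List (Fin n)
leaves* : ∀ {n} → List (Tree n) → List (Fin n)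
leaves (leaf x)    = x ∷ []
leaves (node _ ts) = leaves* ts
leaves* []       = []
leaves* (t ∷ ts) = leaves t ++ leaves* ts

-- Nodes with exactly two children count as P-nodes, so Q-nodes have at least
-- three.
data WellFormed {n : ℕ} : Tree n → Set where
  leaf  : ∀ {x} → WellFormed (leaf x)
  pnode : ∀ {ts} → 2 ≤ length ts → All WellFormed ts → WellFormed (node P ts)
  qnode : ∀ {ts} → 3 ≤ length ts → All WellFormed ts → WellFormed (node Q ts)

IsPQTree : ∀ {n} → Tree n → Set
IsPQTree {n} T = WellFormed T × leaves T ↭ allFin n

data _⟶_ {n : ℕ} : Rel (Tree n) 0ℓ where
  permute : ∀ {ts us} → ts ↭ us → node P ts ⟶ node P us
  flip    : ∀ {ts} → node Q ts ⟶ node Q (reverse ts)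
  inside  : ∀ {l ts t u us} → t ⟶ u →
            node l (ts ++ t ∷ us) ⟶ node l (ts ++ u ∷ us)

_~_ : ∀ {n} → Rel (Tree n) 0ℓ
_~_ = Star _⟶_

-- A node of a tree is given by the subtree hanging below it; since the leaves
-- of a PQ-tree are pairwise distinct, no subtree occurs twice.
data _▹_ {n : ℕ} : Rel (Tree n) 0ℓ where
  child : ∀ {l ts t} → t List∈.∈ ts → node l ts ▹ t

NodeOf : ∀ {n} → Tree n → Tree n → Set
NodeOf T α = Star _▹_ T α

X⟨_⟩ : ∀ {n} → Tree n → Pred (Fin n) 0ℓ
X⟨ α ⟩ x = x List∈.∈ leaves α

-- Υ T p α : the node α lies on the path of T between its root and the leaf p.
Υ : ∀ {n} → Tree n → Fin n → Tree n → Set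
Υ T p α = NodeOf T α × Star _▹_ α (leaf p)

Between : ∀ {n} → Rel (Fin n) 0ℓ → Fin n → Fin n → Fin n → Set
Between _<_ x y z = (x < y × y < z) ⊎ (z < y × y < x)

module Space {c ℓ₁ ℓ₂ : Level} {V : Values c ℓ₁ ℓ₂} {n : ℕ}
             (D : Dissimilarity V n) where

  open Values V
  open Dissimilarity D renaming (dist to d)

  IsTotalOrder : Rel (Fin n) 0ℓ → Set
  IsTotalOrder _<_ = IsStrictTotalOrder _≡_ _<_

  Compatible : Rel (Fin n) 0ℓ → Set ℓ₂
  Compatible _<_ = ∀ x y z → x < y → y < z → d x y ≤ᵥ d x z × d y z ≤ᵥ d x z

  Robinson : Set (lsuc 0ℓ ⊔ ℓ₂)
  Robinson = Σ (Rel (Fin n) 0ℓ) λ _<_ → IsTotalOrder _<_ × Compatible _<_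

  IsPQTreeOfSpace : Tree n → Set (lsuc 0ℓ ⊔ ℓ₂)
  IsPQTreeOfSpace T = IsPQTree T ×
    (∀ (_<_ : Rel (Fin n) 0ℓ) → IsTotalOrder _<_ →
      Compatible _<_ ⇔ (∃[ T′ ] T ~ T′ × AllPairs _<_ (leaves T′)))

  Edge : Value → Pred (Fin n) 0ℓ → Rel (Fin n) ℓ₁
  Edge δ S x y = S x × S y × x ≢ y × ¬ (d x y ≈ δ)

  Connected : Value → Pred (Fin n) 0ℓ → Set ℓ₁
  Connected δ S = ∀ x y → S x → S y → Star (Edge δ S) x y

  -- The Q-node with children βs is δ-conical, with apex child the i-th one.
  ConicalAt : Value → (βs : List (Tree n)) → Fin (length βs) → Set ℓ₁
  ConicalAt δ βs i = ∀ j → j ≢ i → ∀ x y →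
    X⟨ lookup βs i ⟩ x → X⟨ lookup βs j ⟩ y → d x y ≈ δ

  ApexChild : Tree n → Value → Tree n → Set ℓ₁
  ApexChild T δ α = Σ[ βs ∈ List (Tree n) ] Σ[ i ∈ Fin (length βs) ]
    NodeOf T (node Q βs) × α ≡ lookup βs i × ConicalAt δ βs i

  SplitAt : Tree n → Value → Tree n → Set ℓ₁
  SplitAt T δ α = ApexChild T δ α × ¬ Connected δ X⟨ α ⟩

  Split : Tree n → Tree n → Set (c ⊔ ℓ₁ ⊔ ℓ₂)
  Split T α = ∃[ δ ] 0# <ᵥ δ × SplitAt T δ α

  Standard : Tree n → Tree n → Set (c ⊔ ℓ₁ ⊔ ℓ₂)
  Standard T α = ¬ Split T α

  -- Every node on Υ(p) that satisfies the splitting condition for some δ does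
  -- so for a positive one.  This is automatic when d x y ≈ 0# only for x ≡ y,
  -- since δ is a distance between points below two different children.  If it
  -- fails, the node in question is standard (as Split asks for δ > 0) but
  -- corresponds to no frontier: take X = {a,b,m,m′,e} with d(b,e) = 1,
  -- d(a,e) = 2 and all other distances 0, and p = m, S = {m,m′}.
  NoZeroSplit : Tree n → Fin n → Set ℓ₁
  NoZeroSplit T p = ∀ α → Υ T p α → ¬ SplitAt T 0# α

  IsMmodule : ∀ {ℓ} → Pred (Fin n) ℓ → Set (ℓ₁ ⊔ ℓ)
  IsMmodule M = ∀ z x y → ¬ M z → M x → M y → d z x ≈ d z y

  -- Nonemptiness only matters when X = {p}, where ∅ would otherwise be a
  -- copoint and the copoints with {p} would not form a partition.
  Copoint : Fin n → Subset n → Set ℓ₁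
  Copoint p C = Nonempty C × IsMmodule (_∈ C) × p ∉ C ×
    (∀ M → IsMmodule (_∈ M) → p ∉ M → C ⊆ M → M ⊆ C)

  𝒞 : Fin n → Set ℓ₁
  𝒞 p = Σ[ C ∈ Subset n ] (C ≡ ⁅ p ⁆ ⊎ Copoint p C)

  C₀ : ∀ p → 𝒞 p
  C₀ p = ⁅ p ⁆ , inj₁ refl

  _∈𝒞_ : ∀ {p} → Fin n → 𝒞 p → Set
  x ∈𝒞 C = x ∈ proj₁ C

  _≈𝒞_ : ∀ {p} → Rel (𝒞 p) 0ℓ
  _≈𝒞_ = _≡_ on proj₁

  -- In PO1, d(C,p) is the common value of d x p over x ∈ C.  That C₀ comes
  -- first is implied by PO1 unless some other point is at distance 0 from p.
  record IsProximityOrder {ℓ : Level} (p : Fin n) (_<_ : Rel (Fin n) 0ℓ)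
                          (_≺_ : Rel (𝒞 p) ℓ) : Set (ℓ ⊔ ℓ₁ ⊔ ℓ₂) where
    field
      isStrictTotalOrder : IsStrictTotalOrder _≈𝒞_ _≺_
      C₀-first : ∀ C → ¬ (C ≺ C₀ p)
      PO1 : ∀ {C C′} → C ≺ C′ → ∀ x y → x ∈𝒞 C → y ∈𝒞 C′ → d x p ≤ᵥ d y p
      PO2 : ∀ {C C′} → C ≺ C′ → ∀ x y → x ∈𝒞 C → y ∈𝒞 C′ →
            ¬ Between _<_ p y x

  IsUniversal : ∀ {ℓ} (p : Fin n) → Rel (𝒞 p) ℓ → Set (lsuc 0ℓ ⊔ ℓ ⊔ ℓ₁ ⊔ ℓ₂)
  IsUniversal p _≺_ = ∀ (_<_ : Rel (Fin n) 0ℓ) → IsTotalOrder _<_ →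
    Compatible _<_ → IsProximityOrder p _<_ _≺_

  -- [C₀, C]: the union of the members of 𝒞 p up to and including C.
  [C₀,_]⟨_⟩ : ∀ {ℓ} {p : Fin n} → 𝒞 p → Rel (𝒞 p) ℓ → Pred (Fin n) (ℓ ⊔ ℓ₁)
  [C₀, C ]⟨ _≺_ ⟩ x = ∃[ B ] (B ≺ C ⊎ B ≈𝒞 C) × x ∈𝒞 B

  Frontier : ∀ {ℓ} {p : Fin n} → Rel (𝒞 p) ℓ → 𝒞 p → Set (ℓ ⊔ ℓ₁)
  Frontier _≺_ C = IsMmodule [C₀, C ]⟨ _≺_ ⟩

{-# OPTIONS --safe #-}

-- Reversing an interval that is an mmodule turns a compatible order into a
-- compatible order, and every node of the PQ-tree is an interval mmodule.
--
-- Let α be a standard node above p.  If a p-copoint C crosses X(α), then all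
-- distances between X(α) ∖ C and C equal one value δ.  So do those between X(α)
-- and its siblings: otherwise the hull of X(α) ∪ C is an interval mmodule that
-- omits part of the parent, and reversing it violates the tree, unless the
-- parent is a P-node, where some order puts the omitted part inside the hull.
-- If the parent is a Q-node, then α is split; if it is a P-node, a sibling of α
-- can be moved inside X(α).  Hence X(α) is a union of members of 𝒞 p.  By PO2 it
-- is an initial one: after reversing X(α) if necessary, any of its points other
-- than p lies between p and a given point outside.
--
-- Conversely, PO2 makes [C₀, C] an interval in every compatible order.  If it is
-- an mmodule, then it is all of the lowest node containing it, again by a
-- reversal.  This node is not split: the rest of the parent after removing the
-- component of p would be an mmodule without p crossing it.

module Submission where

open import Defs
open import Level using (Level; 0ℓ)
open import Effect.Monad using (RawMonad)
open import Data.Empty using (⊥; ⊥-elim)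
open import Data.Nat using (ℕ; zero; suc; s≤s)
open import Data.Fin using (Fin; zero; suc)
import Data.Fin as Fin
open import Data.Fin.Properties using (<-cmp; all?; any?; _≟_; sequence)
import Data.Fin.Properties as Fin
open import Data.Fin.Subset using (Subset; _∈_; _∉_; ⁅_⁆)
open import Data.Fin.Subset.Properties using (_∈?_; anySubset?; x∈⁅x⁆; x∈⁅y⁆⇒x≡y)
open import Data.List using (List; []; _∷_; _++_; length; lookup; reverse; allFin; filter)
open import Data.List.Properties
  using (tabulate-lookup; ++-assoc; ++-identityʳ; reverse-involutive; unfold-reverse)
open import Data.List.Membership.Propositional using () renaming (_∈_ to _∈ₗ_)
open import Data.List.Membership.Propositional.Properties
  using (∈-++⁺ˡ; ∈-++⁺ʳ; ∈-++⁻; ∈-allFin; ∈-lookup; ∈-∃++; ∈-filter⁺)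
import Data.List.Extrema as Extrema
import Data.List.Membership.DecPropositional as DecMembership
open import Data.List.Relation.Unary.Any using (here; there; index)
open import Data.List.Relation.Unary.Any.Properties using (lookup-index)
open import Data.List.Relation.Unary.All as All using (All; []; _∷_)
import Data.List.Relation.Unary.All.Properties as All
open import Data.List.Relation.Unary.AllPairs as AllPairs using (AllPairs; []; _∷_)
import Data.List.Relation.Unary.AllPairs.Properties as AllPairs
open import Data.List.Relation.Unary.Unique.Propositional using (Unique)
open import Data.List.Relation.Unary.Unique.Propositional.Properties using (allFin⁺)
open import Data.List.Relation.Binary.Permutation.Propositional
  using (_↭_; refl; prep; swap; trans; ↭-refl; ↭-sym; ↭-trans; ↭⇒↭ₛ)
open import Data.List.Relation.Binary.Permutation.Propositional.Properties
  using (∈-resp-↭; All-resp-↭; ↭-reverse; shift; ++⁺ˡ; ++⁺ʳ; shifts)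
import Data.List.Relation.Binary.Permutation.Setoid.Properties as PermutationSetoid
import Data.Vec as Vec
import Data.Vec.Properties as Vec
open import Data.Product using (Σ; Σ-syntax; ∃₂; ∃-syntax; _×_; _,_; proj₁; proj₂)
open import Data.Sum using (_⊎_; inj₁; inj₂; [_,_]′)
import Data.Sum as Sum
open import Function using (_∘_; id) renaming (flip to converse)
open import Function.Bundles using (_⇔_; mk⇔; Equivalence)
open import Relation.Nullary using (¬_; Dec; yes; no; does; contradiction)
open import Relation.Nullary.Negation using (¬¬-Monad)
import Relation.Nullary.Decidable as Dec
open import Relation.Nullary.Decidable using (_×-dec_; _⊎-dec_; _→-dec_; ¬?; ¬¬-excluded-middle)
open import Relation.Unary using (Pred; Decidable; _≐_)
open import Relation.Binary using (Rel; Symmetric; IsStrictTotalOrder; tri<; tri≈; tri>)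
import Relation.Binary as B
import Relation.Binary.Properties.StrictTotalOrder as StrictTotalOrderProperties
open import Relation.Binary.PropositionalEquality
  using (_≡_; _≢_; refl; sym; cong; subst; subst₂; resp₂; setoid; isEquivalence; module ≡-Reasoning)
  renaming (trans to ≡-trans)
open import Relation.Binary.Construct.Closure.ReflexiveTransitive using (Star; ε; _◅_; _◅◅_)
import Relation.Binary.Construct.Closure.ReflexiveTransitive as Star

private
  variable
    a r : Level
    A : Set a
    n : ℕ

-- Pairwise relations on lists

AllPairs-resp-↭ : {R : Rel A r} {xs ys : List A} → Symmetric R →
                  xs ↭ ys → AllPairs R xs → AllPairs R ys
AllPairs-resp-↭ {R = R} R-sym p =
  PermutationSetoid.AllPairs-resp-↭ (setoid _) R-sym (resp₂ R) (↭⇒↭ₛ p)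

AllPairs-++⁻ : {R : Rel A r} (xs : List A) {ys : List A} → AllPairs R (xs ++ ys) →
               All (λ x → All (R x) ys) xs × AllPairs R ys
AllPairs-++⁻ []       rs       = [] , rs
AllPairs-++⁻ (x ∷ xs) (r ∷ rs) with AllPairs-++⁻ xs rs
... | xRys , rys = All.++⁻ʳ xs r ∷ xRys , rys

AllPairs-∈-++⁻ : {R : Rel A r} (xs : List A) {ys : List A} → AllPairs R (xs ++ ys) →
                 ∀ {x y} → x ∈ₗ xs → y ∈ₗ ys → R x y
AllPairs-∈-++⁻ xs rs x∈ y∈ = All.lookup (All.lookup (proj₁ (AllPairs-++⁻ xs rs)) x∈) y∈

AllPairs-++⁻ˡ : {R : Rel A r} (xs : List A) {ys : List A} →
                AllPairs R (xs ++ ys) → AllPairs R xs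
AllPairs-++⁻ˡ []       rs       = []
AllPairs-++⁻ˡ (x ∷ xs) (r ∷ rs) = All.++⁻ˡ xs r ∷ AllPairs-++⁻ˡ xs rs

AllPairs-reverse : {R : Rel A r} {xs : List A} →
                   AllPairs R xs → AllPairs (converse R) (reverse xs)
AllPairs-reverse {xs = []}     _        = []
AllPairs-reverse {xs = x ∷ xs} (r ∷ rs) rewrite unfold-reverse x xs =
  AllPairs.++⁺ (AllPairs-reverse rs) ([] ∷ [])
    (All.map (_∷ []) (All-resp-↭ (↭-sym (↭-reverse xs)) r))

AllPairs-∈ : {R : Rel A r} {xs : List A} → AllPairs R xs →
             ∀ {x y} → x ∈ₗ xs → y ∈ₗ xs → x ≡ y ⊎ R x y ⊎ R y x
AllPairs-∈ (_ ∷ _)  (here refl) (here refl) = inj₁ refl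
AllPairs-∈ (r ∷ _)  (here refl) (there y∈)  = inj₂ (inj₁ (All.lookup r y∈))
AllPairs-∈ (r ∷ _)  (there x∈)  (here refl) = inj₂ (inj₂ (All.lookup r x∈))
AllPairs-∈ (_ ∷ rs) (there x∈)  (there y∈)  = AllPairs-∈ rs x∈ y∈

AllPairs-lookup : {R : Rel A r} {xs : List A} → Symmetric R → AllPairs R xs →
                  ∀ {i j} → i ≢ j → R (lookup xs i) (lookup xs j)
AllPairs-lookup R-sym (_ ∷ _)  {zero}  {zero}  i≢j = contradiction refl i≢j
AllPairs-lookup R-sym (r ∷ _)  {zero}  {suc j} i≢j = All.lookup r (∈-lookup j)
AllPairs-lookup R-sym (r ∷ _)  {suc i} {zero}  i≢j = R-sym (All.lookup r (∈-lookup i))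
AllPairs-lookup R-sym (_ ∷ rs) {suc i} {suc j} i≢j =
  AllPairs-lookup R-sym rs (i≢j ∘ cong suc)

AllPairs-replace : {R : Rel A r} {x y : A} →
                   (∀ {z} → R z y → R z x) → (∀ {z} → R y z → R x z) →
                   ∀ xs {ys} → AllPairs R (xs ++ y ∷ ys) → AllPairs R (xs ++ x ∷ ys)
AllPairs-replace f g []       (r ∷ rs) = All.map g r ∷ rs
AllPairs-replace f g (z ∷ xs) (r ∷ rs) with All.++⁻ xs r
... | r₁ , r₂ ∷ r₃ = All.++⁺ r₁ (f r₂ ∷ r₃) ∷ AllPairs-replace f g xs rs

to-front : {xs : List A} {x : A} → x ∈ₗ xs → ∃[ ys ] xs ↭ x ∷ ys
to-front x∈ with ∈-∃++ x∈
... | ys , zs , refl = ys ++ zs , shift _ ys zs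

remove-∈ : {x y : A} {xs : List A} → y ∈ₗ x ∷ xs → y ≢ x → y ∈ₗ xs
remove-∈ (here y≡x) y≢x = contradiction y≡x y≢x
remove-∈ (there y∈) y≢x = y∈

-- Total orders from listings, maxima, finite subsets

module ListingOrder {xs : List (Fin n)} (xs↭ : xs ↭ allFin n) where

  unique : Unique xs
  unique = AllPairs-resp-↭ (_∘ sym) (↭-sym xs↭) (allFin⁺ n)

  complete : ∀ x → x ∈ₗ xs
  complete x = ∈-resp-↭ (↭-sym xs↭) (∈-allFin x)

  rank : Fin n → Fin (length xs)
  rank x = index (complete x)

  lookup-rank : ∀ x → x ≡ lookup xs (rank x)
  lookup-rank x = lookup-index (complete x)

  rank-lookup : ∀ i → rank (lookup xs i) ≡ i
  rank-lookup i with rank (lookup xs i) ≟ i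
  ... | yes eq = eq
  ... | no neq = contradiction (sym (lookup-rank (lookup xs i)))
                   (AllPairs-lookup (_∘ sym) unique neq)

  rank-injective : ∀ {x y} → rank x ≡ rank y → x ≡ y
  rank-injective {x} {y} eq =
    ≡-trans (lookup-rank x) (≡-trans (cong (lookup xs) eq) (sym (lookup-rank y)))

  _<_ : Rel (Fin n) 0ℓ
  x < y = rank x Fin.< rank y

  isStrictTotalOrder : IsStrictTotalOrder _≡_ _<_
  isStrictTotalOrder = record
    { isStrictPartialOrder = record
      { isEquivalence = isEquivalence
      ; irrefl        = λ { refl → Fin.<-irrefl refl }
      ; trans         = Fin.<-trans
      ; <-resp-≈      = resp₂ _<_
      }
    ; compare = compare
    }
    where
    compare : B.Trichotomous _≡_ _<_
    compare x y with <-cmp (rank x) (rank y)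
    ... | tri< l ¬e ¬g = tri< l (¬e ∘ cong rank) ¬g
    ... | tri≈ ¬l e ¬g = tri≈ ¬l (rank-injective e) ¬g
    ... | tri> ¬l ¬e g = tri> ¬l (¬e ∘ cong rank) g

  sorted : AllPairs _<_ xs
  sorted = subst (AllPairs _<_) (tabulate-lookup xs)
    (AllPairs.tabulate⁺-< {R = _<_} {f = lookup xs}
      (λ {i} {j} → subst₂ Fin._<_ (sym (rank-lookup i)) (sym (rank-lookup j))))

module _ {a ℓ₁ ℓ₂ : Level} (O : B.StrictTotalOrder a ℓ₁ ℓ₂) where

  open B.StrictTotalOrder O using (Carrier)
  open StrictTotalOrderProperties O using (totalOrder) renaming (_≤_ to _≼_)
  open Extrema totalOrder using (argmax; argmax-all; f[xs]≤f[argmax])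

  -- The point `k` serves as the default value of the search. The lemma is applied to points under a
  -- compatible order, with `f` the identity, and to members of `𝒞 p` under `≺`, with `f` sending a
  -- point to its member.
  maximum : (f : Fin n → Carrier) {Pr : Pred (Fin n) r} → Decidable Pr → ∀ {k} → Pr k →
            ∃[ m ] Pr m × (∀ {x} → Pr x → f x ≼ f m)
  maximum {n} f Pr? {k} k∈ =
    argmax f k (filter Pr? (allFin n)) ,
    argmax-all f k∈ (All.all-filter Pr? (allFin n)) ,
    λ {x} x∈ → All.lookup (f[xs]≤f[argmax] k (filter Pr? (allFin n)))
                          (∈-filter⁺ Pr? (∈-allFin x) x∈)

toSubset : {Pr : Pred (Fin n) r} → Decidable Pr → Subset n
toSubset Pr? = Vec.tabulate (does ∘ Pr?)

module _ {Pr : Pred (Fin n) r} (Pr? : Decidable Pr) where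

  ∈-toSubset⁺ : ∀ {x} → Pr x → x ∈ toSubset Pr?
  ∈-toSubset⁺ {x} px =
    Vec.lookup⇒[]= x _ (≡-trans (Vec.lookup∘tabulate (does ∘ Pr?) x) (Dec.dec-true (Pr? x) px))

  ∈-toSubset⁻ : ∀ {x} → x ∈ toSubset Pr? → Pr x
  ∈-toSubset⁻ {x} x∈
    with Pr? x | ≡-trans (sym (Vec.lookup∘tabulate (does ∘ Pr?) x)) (Vec.[]=⇒lookup x∈)
  ... | yes px | _ = px
  ... | no _   | ()

-- Leaves, nodes and contexts of PQ-trees

tree-induction : {Pr : Tree n → Set r} →
                 (∀ x → Pr (leaf x)) → (∀ l {ts} → All Pr ts → Pr (node l ts)) →
                 ∀ t → Pr t
tree-induction {Pr = Pr} at-leaf at-node = go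
  where
  go  : ∀ t → Pr t
  go* : ∀ ts → All Pr ts
  go (leaf x)    = at-leaf x
  go (node l ts) = at-node l (go* ts)
  go* []       = []
  go* (t ∷ ts) = go t ∷ go* ts

_∈X?_ : (x : Fin n) (t : Tree n) → Dec (X⟨ t ⟩ x)
x ∈X? t = DecMembership._∈?_ _≟_ x (leaves t)

∈leaves*⁺ : ∀ {ts : List (Tree n)} {t x} → t ∈ₗ ts → X⟨ t ⟩ x → x ∈ₗ leaves* ts
∈leaves*⁺ (here refl) x∈ = ∈-++⁺ˡ x∈
∈leaves*⁺ {ts = t ∷ _} (there t∈) x∈ = ∈-++⁺ʳ (leaves t) (∈leaves*⁺ t∈ x∈)

∈leaves*⁻ : ∀ (ts : List (Tree n)) {x} → x ∈ₗ leaves* ts → ∃[ t ] t ∈ₗ ts × X⟨ t ⟩ x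
∈leaves*⁻ (t ∷ ts) x∈ with ∈-++⁻ (leaves t) x∈
... | inj₁ x∈t = t , here refl , x∈t
... | inj₂ x∈ts with ∈leaves*⁻ ts x∈ts
...   | u , u∈ , x∈u = u , there u∈ , x∈u

leaves*-++ : ∀ (ts : List (Tree n)) {us} → leaves* (ts ++ us) ≡ leaves* ts ++ leaves* us
leaves*-++ []       = refl
leaves*-++ (t ∷ ts) = ≡-trans (cong (leaves t ++_) (leaves*-++ ts))
                              (sym (++-assoc (leaves t) (leaves* ts) _))

leaves*-↭ : ∀ {ts us : List (Tree n)} → ts ↭ us → leaves* ts ↭ leaves* us
leaves*-↭ refl        = ↭-refl
leaves*-↭ (prep t p)  = ++⁺ˡ (leaves t) (leaves*-↭ p)
leaves*-↭ (swap t u p) =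
  ↭-trans (shifts (leaves t) (leaves u)) (++⁺ˡ (leaves u) (++⁺ˡ (leaves t) (leaves*-↭ p)))
leaves*-↭ (trans p q) = ↭-trans (leaves*-↭ p) (leaves*-↭ q)

⟶-leaves : ∀ {t u : Tree n} → t ⟶ u → leaves t ↭ leaves u
⟶-leaves (permute p)  = leaves*-↭ p
⟶-leaves (flip {ts})  = leaves*-↭ (↭-sym (↭-reverse ts))
⟶-leaves (inside {ts = ts} {t} {u} {us} s)
  rewrite leaves*-++ ts {t ∷ us} | leaves*-++ ts {u ∷ us} =
  ++⁺ˡ (leaves* ts) (++⁺ʳ (leaves* us) (⟶-leaves s))

~-leaves : ∀ {t u : Tree n} → t ~ u → leaves t ↭ leaves u
~-leaves ε       = ↭-refl
~-leaves (s ◅ p) = ↭-trans (⟶-leaves s) (~-leaves p)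

⟶-reverse : ∀ l {ts : List (Tree n)} → node l ts ⟶ node l (reverse ts)
⟶-reverse P {ts} = permute (↭-sym (↭-reverse ts))
⟶-reverse Q      = flip

WellFormed-children : ∀ {l} {ts : List (Tree n)} → WellFormed (node l ts) → All WellFormed ts
WellFormed-children (pnode _ ws) = ws
WellFormed-children (qnode _ ws) = ws

WellFormed-node : ∀ {t u : Tree n} → NodeOf t u → WellFormed t → WellFormed u
WellFormed-node ε                w = w
WellFormed-node (child t∈ ◅ path) w =
  WellFormed-node path (All.lookup (WellFormed-children w) t∈)

WellFormed⇒nonempty : ∀ (t : Tree n) → WellFormed t → ∃[ x ] X⟨ t ⟩ x
WellFormed⇒nonempty = tree-induction (λ x _ → x , here refl) at-node
  where
  at-node : ∀ l {ts} → All (λ t → WellFormed t → ∃[ x ] X⟨ t ⟩ x) ts →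
            WellFormed (node l ts) → ∃[ x ] X⟨ node l ts ⟩ x
  at-node l {[]} _ (pnode () _)
  at-node l {[]} _ (qnode () _)
  at-node l {t ∷ ts} (ih ∷ _) w with ih (All.head (WellFormed-children w))
  ... | x , x∈ = x , ∈-++⁺ˡ x∈

node-⊆ : ∀ {t u : Tree n} → NodeOf t u → ∀ {x} → X⟨ u ⟩ x → X⟨ t ⟩ x
node-⊆ ε                 x∈ = x∈
node-⊆ (child t∈ ◅ path) x∈ = ∈leaves*⁺ t∈ (node-⊆ path x∈)

path-to-leaf : ∀ {x} (t : Tree n) → X⟨ t ⟩ x → Star _▹_ t (leaf x)
path-to-leaf {x = x} = tree-induction (λ { y (here refl) → ε }) at-node
  where
  at-node : ∀ l {ts} → All (λ t → X⟨ t ⟩ x → Star _▹_ t (leaf x)) ts →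
            X⟨ node l ts ⟩ x → Star _▹_ (node l ts) (leaf x)
  at-node l {ts} ihs x∈ with ∈leaves*⁻ ts x∈
  ... | t , t∈ , x∈t = child t∈ ◅ All.lookup ihs t∈ x∈t

parent : ∀ {t u : Tree n} → NodeOf t u →
         t ≡ u ⊎ (∃₂ λ l ts → NodeOf t (node l ts) × u ∈ₗ ts)
parent ε = inj₁ refl
parent (child {l} {ts} t∈ ◅ path) with parent path
... | inj₁ refl = inj₂ (l , ts , ε , t∈)
... | inj₂ (l′ , us , path′ , u∈) = inj₂ (l′ , us , child t∈ ◅ path′ , u∈)

-- The lists `before` and `after` do not depend on `η′`. Hence a point outside `η` is on the same
-- side of `η` in the leaf orders before and after a step at `η`.
record Context (T η : Tree n) : Set where
  field
    before after : List (Fin n)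
    leaves-≡     : leaves T ≡ before ++ leaves η ++ after
    replace      : ∀ {η′} → η ⟶ η′ →
                   ∃[ T′ ] T ⟶ T′ × leaves T′ ≡ before ++ leaves η′ ++ after

context : ∀ {T η : Tree n} → NodeOf T η → Context T η
context {η = η} ε = record
  { before   = []
  ; after    = []
  ; leaves-≡ = sym (++-identityʳ _)
  ; replace  = λ {η′} s → η′ , s , sym (++-identityʳ _)
  }
context {η = η} (child {l} {_} {t} t∈ ◅ path) with context path | ∈-∃++ t∈
... | record { before = as ; after = bs ; leaves-≡ = eq ; replace = rep } | ts , us , refl = record
  { before   = leaves* ts ++ as
  ; after    = bs ++ leaves* us
  ; leaves-≡ = around η t eq
  ; replace  = λ {η′} s → let (t′ , s′ , eq′) = rep s in
      node l (ts ++ t′ ∷ us) , inside s′ , around η′ t′ eq′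
  }
  where
  open ≡-Reasoning
  around : ∀ v w → leaves w ≡ as ++ leaves v ++ bs →
           leaves* (ts ++ w ∷ us) ≡ (leaves* ts ++ as) ++ leaves v ++ bs ++ leaves* us
  around v w e = begin
    leaves* (ts ++ w ∷ us)
      ≡⟨ leaves*-++ ts ⟩
    leaves* ts ++ leaves w ++ leaves* us
      ≡⟨ cong (λ ■ → leaves* ts ++ ■ ++ leaves* us) e ⟩
    leaves* ts ++ (as ++ leaves v ++ bs) ++ leaves* us
      ≡⟨ cong (leaves* ts ++_) (++-assoc as _ _) ⟩
    leaves* ts ++ as ++ (leaves v ++ bs) ++ leaves* us
      ≡⟨ cong (λ ■ → leaves* ts ++ as ++ ■) (++-assoc (leaves v) bs _) ⟩
    leaves* ts ++ as ++ leaves v ++ bs ++ leaves* us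
      ≡⟨ ++-assoc (leaves* ts) as _ ⟨
    (leaves* ts ++ as) ++ leaves v ++ bs ++ leaves* us ∎

-- Orders arranging a tree

module _ (_<_ : Rel (Fin n) 0ℓ) where

  Precedes : Rel (Tree n) 0ℓ
  Precedes s t = ∀ {x y} → X⟨ s ⟩ x → X⟨ t ⟩ y → x < y

  Apart : Rel (Tree n) 0ℓ
  Apart s t = Precedes s t ⊎ Precedes t s

  Lined : Label → List (Tree n) → Set
  Lined P ts = AllPairs Apart ts
  Lined Q ts = AllPairs Precedes ts ⊎ AllPairs (converse Precedes) ts

  -- Satisfied by the orders that list the leaves of some equivalent tree.
  data Arranged : Tree n → Set where
    leaf : ∀ {x} → Arranged (leaf x)
    node : ∀ {l ts} → All Arranged ts → Lined l ts → Arranged (node l ts)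

module _ {_<_ : Rel (Fin n) 0ℓ} where

  Lined⇒Apart : ∀ l {ts} → Lined _<_ l ts → AllPairs (Apart _<_) ts
  Lined⇒Apart P ap        = ap
  Lined⇒Apart Q (inj₁ ap) = AllPairs.map inj₁ ap
  Lined⇒Apart Q (inj₂ ap) = AllPairs.map inj₂ ap

  Precedes⇒Lined : ∀ l {ts} → AllPairs (Precedes _<_) ts → Lined _<_ l ts
  Precedes⇒Lined P ap = AllPairs.map inj₁ ap
  Precedes⇒Lined Q ap = inj₁ ap

  sorted⇒Precedes : ∀ ts → AllPairs _<_ (leaves* ts) → AllPairs (Precedes _<_) ts
  sorted⇒Precedes []       _  = []
  sorted⇒Precedes (t ∷ ts) ap =
    All.tabulate (λ s∈ x∈ y∈ → AllPairs-∈-++⁻ (leaves t) ap x∈ (∈leaves*⁺ s∈ y∈)) ∷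
    sorted⇒Precedes ts (proj₂ (AllPairs-++⁻ (leaves t) ap))

  sorted⇒Arranged : ∀ t → AllPairs _<_ (leaves t) → Arranged _<_ t
  sorted⇒Arranged = tree-induction (λ _ _ → leaf) at-node
    where
    children : ∀ {ts} → All (λ t → AllPairs _<_ (leaves t) → Arranged _<_ t) ts →
               AllPairs _<_ (leaves* ts) → All (Arranged _<_) ts
    children []                _  = []
    children (_∷_ {t} ih ihs) ap =
      ih (AllPairs-++⁻ˡ (leaves t) ap) ∷ children ihs (proj₂ (AllPairs-++⁻ (leaves t) ap))
    at-node : ∀ l {ts} → All (λ t → AllPairs _<_ (leaves t) → Arranged _<_ t) ts →
              AllPairs _<_ (leaves* ts) → Arranged _<_ (node l ts)
    at-node l {ts} ihs ap = node (children ihs ap) (Precedes⇒Lined l (sorted⇒Precedes ts ap))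

  Arranged-node : ∀ {t u} → NodeOf t u → Arranged _<_ t → Arranged _<_ u
  Arranged-node ε                 arr          = arr
  Arranged-node (child t∈ ◅ path) (node arrs _) = Arranged-node path (All.lookup arrs t∈)

  -- `Apart` is symmetric, so permuting the children of a P-node is harmless. Flipping a Q-node
  -- exchanges the two alternatives of `Lined`. A step inside a child keeps its leaf set, which is
  -- all that its siblings see.
  ⟶-Arranged : ∀ {t u} → t ⟶ u → Arranged _<_ u → Arranged _<_ t
  ⟶-Arranged (permute p) (node arrs ap) =
    node (All-resp-↭ (↭-sym p) arrs) (AllPairs-resp-↭ Sum.swap (↭-sym p) ap)
  ⟶-Arranged (flip {ts}) (node arrs ap) =
    node (All-resp-↭ (↭-reverse ts) arrs)
         (subst (Lined _<_ Q) (reverse-involutive ts)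
           (Sum.swap (Sum.map AllPairs-reverse AllPairs-reverse ap)))
  ⟶-Arranged (inside {l} {ts} {t} {u} s) (node arrs ap) =
    node (replace-All (All.++⁻ ts arrs)) (replace-Lined l ap)
    where
    t⇒u : ∀ {x} → X⟨ t ⟩ x → X⟨ u ⟩ x
    t⇒u = ∈-resp-↭ (⟶-leaves s)
    replace-All : ∀ {us} → All (Arranged _<_) ts × All (Arranged _<_) (u ∷ us) →
                  All (Arranged _<_) (ts ++ t ∷ us)
    replace-All (as , b ∷ bs) = All.++⁺ as (⟶-Arranged s b ∷ bs)
    to : ∀ {s} → Precedes _<_ s u → Precedes _<_ s t
    to p x∈ y∈ = p x∈ (t⇒u y∈)
    from : ∀ {s} → Precedes _<_ u s → Precedes _<_ t s
    from p x∈ y∈ = p (t⇒u x∈) y∈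
    replace-Lined : ∀ l {us} → Lined _<_ l (ts ++ u ∷ us) → Lined _<_ l (ts ++ t ∷ us)
    replace-Lined P = AllPairs-replace
      (λ {s} → Sum.map (to {s}) (from {s})) (λ {s} → Sum.map (from {s}) (to {s})) ts
    replace-Lined Q = Sum.map
      (AllPairs-replace (λ {s} → to {s}) (λ {s} → from {s}) ts)
      (AllPairs-replace (λ {s} → from {s}) (λ {s} → to {s}) ts)

  ~-Arranged : ∀ {t u} → t ~ u → Arranged _<_ u → Arranged _<_ t
  ~-Arranged ε       arr = arr
  ~-Arranged (s ◅ p) arr = ⟶-Arranged s (~-Arranged p arr)

-- Intervals of a total order and their reversal

IsInterval : Rel (Fin n) 0ℓ → Pred (Fin n) 0ℓ → Set
IsInterval _<_ M = ∀ {x y z} → M x → M z → x < y → y < z → M y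

module TotalOrder {_<_ : Rel (Fin n) 0ℓ} (isTotal : IsStrictTotalOrder _≡_ _<_) where

  open IsStrictTotalOrder isTotal public
    using (compare; asym; _<?_) renaming (irrefl to <-irrefl; trans to <-trans)

  Apart⇒disjoint : ∀ {s t x} → Apart _<_ s t → X⟨ s ⟩ x → ¬ X⟨ t ⟩ x
  Apart⇒disjoint (inj₁ s<t) x∈s x∈t = <-irrefl refl (s<t x∈s x∈t)
  Apart⇒disjoint (inj₂ t<s) x∈s x∈t = <-irrefl refl (t<s x∈t x∈s)

  Lined⇒apart : ∀ l {ts s t y} → Lined _<_ l ts → s ∈ₗ ts → t ∈ₗ ts →
                ¬ X⟨ s ⟩ y → X⟨ t ⟩ y → Apart _<_ s t
  Lined⇒apart l ap s∈ t∈ y∉s y∈t with AllPairs-∈ (Lined⇒Apart l ap) s∈ t∈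
  ... | inj₁ refl        = contradiction y∈t y∉s
  ... | inj₂ (inj₁ s∥t)  = s∥t
  ... | inj₂ (inj₂ t∥s)  = Sum.swap t∥s

  -- Descend towards `u` up to the first child that omits `y`. The sibling containing `y` lies
  -- entirely on one side of that child, so `y` cannot separate two leaves of `u`.
  Arranged⇒interval : ∀ {t u} → Arranged _<_ t → NodeOf t u →
                      ∀ {x y z} → X⟨ t ⟩ y → X⟨ u ⟩ x → X⟨ u ⟩ z → x < y → y < z → X⟨ u ⟩ y
  Arranged⇒interval arr ε y∈t _ _ _ _ = y∈t
  Arranged⇒interval (node {l} {ts} arrs ap) (child {t = s} s∈ ◅ path) {y = y} y∈ x∈u z∈u x<y y<z
    with y ∈X? s
  ... | yes y∈s = Arranged⇒interval (All.lookup arrs s∈) path y∈s x∈u z∈u x<y y<z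
  ... | no  y∉s with ∈leaves*⁻ ts y∈
  ...   | t , t∈ , y∈t with Lined⇒apart l ap s∈ t∈ y∉s y∈t
  ...     | inj₁ s<t = contradiction y<z (asym (s<t (node-⊆ path z∈u) y∈t))
  ...     | inj₂ t<s = contradiction x<y (asym (t<s y∈t (node-⊆ path x∈u)))

  module Reversal {M : Pred (Fin n) 0ℓ} (M? : Decidable M) (M-interval : IsInterval _<_ M) where

    _<ᴿ_ : Rel (Fin n) 0ℓ
    x <ᴿ y = (M x × M y × y < x) ⊎ (¬ (M x × M y) × x < y)

    -- With `above`: a point outside an interval sees all of the interval on one side. This is what
    -- makes the mixed cases of transitivity and compatibility work.
    below : ∀ {x x′ y} → M x → M x′ → ¬ M y → y < x → y < x′
    below {x} {x′} {y} mx mx′ ¬my y<x with compare y x′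
    ... | tri< y<x′ _ _ = y<x′
    ... | tri≈ _ refl _ = contradiction mx′ ¬my
    ... | tri> _ _ x′<y = contradiction (M-interval mx′ mx x′<y y<x) ¬my

    above : ∀ {x x′ y} → M x → M x′ → ¬ M y → x < y → x′ < y
    above {x} {x′} {y} mx mx′ ¬my x<y with compare y x′
    ... | tri> _ _ x′<y = x′<y
    ... | tri≈ _ refl _ = contradiction mx′ ¬my
    ... | tri< y<x′ _ _ = contradiction (M-interval mx mx′ x<y y<x′) ¬my

    <ᴿ-trans : B.Transitive _<ᴿ_
    <ᴿ-trans (inj₁ (mx , my , y<x)) (inj₁ (_ , mz , z<y)) = inj₁ (mx , mz , <-trans z<y y<x)
    <ᴿ-trans (inj₁ (mx , my , y<x)) (inj₂ (¬yz , y<z)) =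
      inj₂ ((λ (_ , mz) → ¬yz (my , mz)) , above my mx (λ mz → ¬yz (my , mz)) y<z)
    <ᴿ-trans (inj₂ (¬xy , x<y)) (inj₁ (my , mz , z<y)) =
      inj₂ ((λ (mx , _) → ¬xy (mx , my)) , below my mz (λ mx → ¬xy (mx , my)) x<y)
    <ᴿ-trans (inj₂ (¬xy , x<y)) (inj₂ (¬yz , y<z)) =
      inj₂ ((λ (mx , mz) → ¬xy (mx , M-interval mx mz x<y y<z)) , <-trans x<y y<z)

    <ᴿ-irrefl : ∀ {x y} → x ≡ y → ¬ (x <ᴿ y)
    <ᴿ-irrefl refl (inj₁ (_ , _ , x<x)) = <-irrefl refl x<x
    <ᴿ-irrefl refl (inj₂ (_ , x<x))     = <-irrefl refl x<x

    <ᴿ-or->ᴿ : ∀ {x y} → x < y → x <ᴿ y ⊎ y <ᴿ x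
    <ᴿ-or->ᴿ {x} {y} x<y with M? x | M? y
    ... | yes mx | yes my = inj₂ (inj₁ (my , mx , x<y))
    ... | yes mx | no ¬my = inj₁ (inj₂ (¬my ∘ proj₂ , x<y))
    ... | no ¬mx | _      = inj₁ (inj₂ (¬mx ∘ proj₁ , x<y))

    <ᴿ-compare : B.Trichotomous _≡_ _<ᴿ_
    <ᴿ-compare x y with compare x y
    ... | tri≈ _ x≡y _ = tri≈ (<ᴿ-irrefl x≡y) x≡y (<ᴿ-irrefl (sym x≡y))
    ... | tri< x<y x≢y _ with <ᴿ-or->ᴿ x<y
    ...   | inj₁ l = tri< l x≢y (λ g → <ᴿ-irrefl refl (<ᴿ-trans l g))
    ...   | inj₂ g = tri> (λ l → <ᴿ-irrefl refl (<ᴿ-trans l g)) x≢y g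
    <ᴿ-compare x y | tri> _ x≢y y<x with <ᴿ-or->ᴿ y<x
    ...   | inj₁ g = tri> (λ l → <ᴿ-irrefl refl (<ᴿ-trans l g)) x≢y g
    ...   | inj₂ l = tri< l x≢y (λ g → <ᴿ-irrefl refl (<ᴿ-trans l g))

    <ᴿ-isStrictTotalOrder : IsStrictTotalOrder _≡_ _<ᴿ_
    <ᴿ-isStrictTotalOrder = record
      { isStrictPartialOrder = record
        { isEquivalence = isEquivalence
        ; irrefl        = <ᴿ-irrefl
        ; trans         = <ᴿ-trans
        ; <-resp-≈      = resp₂ _<ᴿ_
        }
      ; compare = <ᴿ-compare
      }

-- Compatible orders

module _ {c ℓ₁ ℓ₂ : Level} {V : Values c ℓ₁ ℓ₂} (D : Dissimilarity V n) where

  open Space D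
  open Values V
  open Dissimilarity D renaming (dist to d)
  open B.DecTotalOrder decTotalOrder
    using (module Eq; antisym; ≤-respˡ-≈; ≤-respʳ-≈)
    renaming (trans to ≤ᵥ-trans; reflexive to ≤ᵥ-reflexive; _≟_ to _≈?_)

  module _ {_<_ : Rel (Fin n) 0ℓ} (isTotal : IsTotalOrder _<_) (compatible : Compatible _<_) where

    open TotalOrder isTotal

    -- A triple inside `M` is read backwards. If only two consecutive points lie in `M`, they are
    -- equidistant from the third, which turns one of the two inequalities into an equality and the
    -- other into an instance of the original compatibility.
    reversal-compatible : ∀ {M : Pred (Fin n) 0ℓ} (M? : Decidable M)
                          (M-interval : IsInterval _<_ M) → IsMmodule M →
                          Compatible (Reversal._<ᴿ_ M? M-interval)
    reversal-compatible {M} M? M-interval M-mmodule = go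
      where
      open Reversal M? M-interval
      go : Compatible _<ᴿ_
      go x y z (inj₁ (mx , my , y<x)) (inj₁ (_ , mz , z<y)) with compatible z y x z<y y<x
      ... | zy≤zx , yx≤zx =
        ≤-respˡ-≈ (symm y x) (≤-respʳ-≈ (symm z x) yx≤zx) ,
        ≤-respˡ-≈ (symm z y) (≤-respʳ-≈ (symm z x) zy≤zx)
      go x y z (inj₁ (mx , my , y<x)) (inj₂ (¬yz , y<z)) =
        ≤-respˡ-≈ (symm y x) (≤-respʳ-≈ yz≈xz (proj₁ (compatible y x z y<x x<z))) ,
        ≤ᵥ-reflexive yz≈xz
        where
        ¬mz : ¬ M z
        ¬mz mz = ¬yz (my , mz)
        x<z : x < z
        x<z = above my mx ¬mz y<z
        yz≈xz : d y z ≈ d x z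
        yz≈xz = Eq.trans (symm y z) (Eq.trans (M-mmodule z y x ¬mz my mx) (symm z x))
      go x y z (inj₂ (¬xy , x<y)) (inj₁ (my , mz , z<y)) =
        ≤ᵥ-reflexive xy≈xz ,
        ≤-respˡ-≈ (symm z y) (≤-respʳ-≈ xy≈xz (proj₂ (compatible x z y x<z z<y)))
        where
        ¬mx : ¬ M x
        ¬mx mx = ¬xy (mx , my)
        x<z : x < z
        x<z = below my mz ¬mx x<y
        xy≈xz : d x y ≈ d x z
        xy≈xz = M-mmodule x y z ¬mx my mz
      go x y z (inj₂ (_ , x<y)) (inj₂ (_ , y<z)) = compatible x y z x<y y<z

    reversal : ∀ {M : Pred (Fin n) 0ℓ} → Decidable M → IsInterval _<_ M → IsMmodule M → Robinson
    reversal M? M-interval M-mmodule =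
      Reversal._<ᴿ_ M? M-interval ,
      Reversal.<ᴿ-isStrictTotalOrder M? M-interval ,
      reversal-compatible M? M-interval M-mmodule

    module Hull {M : Pred (Fin n) 0ℓ} (M? : Decidable M) where

      HasBelow HasAbove Hull : Pred (Fin n) 0ℓ
      HasBelow y = ∃[ x ] M x × (x < y ⊎ x ≡ y)
      HasAbove y = ∃[ z ] M z × (y < z ⊎ y ≡ z)
      Hull y = HasBelow y × HasAbove y

      Hull? : Decidable Hull
      Hull? y = any? (λ x → M? x ×-dec ((x <? y) ⊎-dec (x ≟ y)))
          ×-dec any? (λ z → M? z ×-dec ((y <? z) ⊎-dec (y ≟ z)))

      ⊆Hull : ∀ {x} → M x → Hull x
      ⊆Hull {x} mx = (x , mx , inj₂ refl) , (x , mx , inj₂ refl)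

      Hull-interval : IsInterval _<_ Hull
      Hull-interval ((x , mx , x≤) , _) (_ , (z , mz , ≤z)) x<y y<z =
        (x , mx , inj₁ ([ (λ x< → <-trans x< x<y) , (λ { refl → x<y }) ]′ x≤)) ,
        (z , mz , inj₁ ([ (λ <z → <-trans y<z <z) , (λ { refl → y<z }) ]′ ≤z))

      module _ (M-mmodule : IsMmodule M) where

        -- A point `w` outside the hull lies on one side of both `x` and `z`, and `y` lies between
        -- these. Compatibility puts `d w y` between `d w x` and `d w z`, which agree since `M` is
        -- an mmodule.
        Hull-distance : ∀ {w y} → ¬ Hull w → ((x , _) : HasBelow y) → HasAbove y → d w y ≈ d w x
        Hull-distance w∉ (x , mx , inj₂ refl) _ = Eq.refl
        Hull-distance {w} w∉ (x , mx , inj₁ _) (z , mz , inj₂ refl) =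
          M-mmodule w z x (w∉ ∘ ⊆Hull) mz mx
        Hull-distance {w} {y} w∉ (x , mx , inj₁ x<y) (z , mz , inj₁ y<z) with compare w x
        ... | tri≈ _ refl _ = contradiction (⊆Hull mx) w∉
        ... | tri< w<x _ _ = antisym
          (≤-respʳ-≈ (M-mmodule w z x (w∉ ∘ ⊆Hull) mz mx)
            (proj₁ (compatible w y z (<-trans w<x x<y) y<z)))
          (proj₁ (compatible w x y w<x x<y))
        ... | tri> _ _ x<w with compare w z
        ...   | tri< w<z _ _ = contradiction ((x , mx , inj₁ x<w) , (z , mz , inj₁ w<z)) w∉
        ...   | tri≈ _ refl _ = contradiction (⊆Hull mz) w∉
        ...   | tri> _ _ z<w = antisym
          (≤-respˡ-≈ (symm y w) (≤-respʳ-≈ (symm x w)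
            (proj₂ (compatible x y w x<y (<-trans y<z z<w)))))
          (≤-respˡ-≈ (Eq.trans (symm z w) (M-mmodule w z x (w∉ ∘ ⊆Hull) mz mx))
            (≤-respʳ-≈ (symm y w) (proj₂ (compatible y z w y<z z<w))))

        Hull-mmodule : IsMmodule Hull
        Hull-mmodule w y y′ w∉ (b@(x , mx , _) , a) (b′@(x′ , mx′ , _) , a′) =
          Eq.trans (Hull-distance w∉ b a)
            (Eq.trans (M-mmodule w x x′ (w∉ ∘ ⊆Hull) mx mx′) (Eq.sym (Hull-distance w∉ b′ a′)))

  -- Mmodules and copoints

  ∪-mmodule : ∀ {a b} {M : Pred (Fin n) a} {N : Pred (Fin n) b} → IsMmodule M → IsMmodule N →
              ∀ {x} → M x → N x → IsMmodule (λ y → M y ⊎ N y)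
  ∪-mmodule {M = M} {N} M-mmodule N-mmodule {x} mx nx z y y′ z∉ y∈ y′∈ =
    Eq.trans (to-x y∈) (Eq.sym (to-x y′∈))
    where
    to-x : ∀ {y} → M y ⊎ N y → d z y ≈ d z x
    to-x {y} (inj₁ my) = M-mmodule z y x (z∉ ∘ inj₁) my mx
    to-x {y} (inj₂ ny) = N-mmodule z y x (z∉ ∘ inj₂) ny nx

  mmodule? : ∀ (M : Subset n) → Dec (IsMmodule (_∈ M))
  mmodule? M = all? λ z → all? λ x → all? λ y →
    ¬? (z ∈? M) →-dec ((x ∈? M) →-dec ((y ∈? M) →-dec (d z x ≈? d z y)))

  IsMmodule-resp-≐ : ∀ {a b} {M : Pred (Fin n) a} {N : Pred (Fin n) b} →
                     M ≐ N → IsMmodule M → IsMmodule N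
  IsMmodule-resp-≐ (M⊆N , N⊆M) M-mmodule z x y z∉ x∈ y∈ =
    M-mmodule z x y (z∉ ∘ M⊆N) (N⊆M x∈) (N⊆M y∈)

  -- Maximality of `B` is applied to the union of `B` and `N`, an mmodule because the two share `x`.
  copoint-absorbs : ∀ {p B} → Copoint p B → {N : Pred (Fin n) r} → Decidable N → IsMmodule N →
                    ¬ N p → ∀ {x} → x ∈ B → N x → ∀ {y} → N y → y ∈ B
  copoint-absorbs {B = B} (_ , B-mmodule , p∉B , B-maximal) {N} N? N-mmodule p∉N x∈B x∈N y∈N =
    B-maximal (toSubset B∪N?)
      (IsMmodule-resp-≐ (∈-toSubset⁺ B∪N? , ∈-toSubset⁻ B∪N?)
        (∪-mmodule B-mmodule N-mmodule x∈B x∈N))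
      ([ p∉B , p∉N ]′ ∘ ∈-toSubset⁻ B∪N?)
      (∈-toSubset⁺ B∪N? ∘ inj₁) (∈-toSubset⁺ B∪N? (inj₂ y∈N))
    where
    B∪N? : Decidable (λ x → x ∈ B ⊎ N x)
    B∪N? x = (x ∈? B) ⊎-dec N? x

  -- The copoint at x is the union of all mmodules containing x but not p.
  module CopointAt {p x : Fin n} (x≢p : x ≢ p) where

    Joined : Pred (Fin n) ℓ₁
    Joined y = Σ[ M ∈ Subset n ] IsMmodule (_∈ M) × p ∉ M × x ∈ M × y ∈ M

    Joined? : Decidable Joined
    Joined? y = anySubset? λ M → mmodule? M ×-dec ¬? (p ∈? M) ×-dec (x ∈? M) ×-dec (y ∈? M)

    x-Joined : Joined x
    x-Joined =
      ⁅ x ⁆ , singleton , (λ p∈ → x≢p (sym (x∈⁅y⁆⇒x≡y x p∈))) , x∈⁅x⁆ x , x∈⁅x⁆ x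
      where
      singleton : IsMmodule (_∈ ⁅ x ⁆)
      singleton _ y y′ _ y∈ y′∈
        with refl ← x∈⁅y⁆⇒x≡y {x = y} x y∈ | refl ← x∈⁅y⁆⇒x≡y {x = y′} x y′∈ = Eq.refl

    Joined-mmodule : IsMmodule Joined
    Joined-mmodule z y y′ z∉ (M , M-mmodule , p∉M , x∈M , y∈M) (N , N-mmodule , p∉N , x∈N , y′∈N) =
      Eq.trans (M-mmodule z y x (λ z∈ → z∉ (M , M-mmodule , p∉M , x∈M , z∈)) y∈M x∈M)
               (N-mmodule z x y′ (λ z∈ → z∉ (N , N-mmodule , p∉N , x∈N , z∈)) x∈N y′∈N)

    copoint : Copoint p (toSubset Joined?)
    copoint =
      (x , ∈-toSubset⁺ Joined? x-Joined) ,
      IsMmodule-resp-≐ (∈-toSubset⁺ Joined? , ∈-toSubset⁻ Joined?) Joined-mmodule ,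
      (λ p∈ → let (_ , _ , p∉M , _ , p∈M) = ∈-toSubset⁻ Joined? p∈ in p∉M p∈M) ,
      (λ M M-mmodule p∉M ⊆M y∈M → ∈-toSubset⁺ Joined?
        (M , M-mmodule , p∉M , ⊆M (∈-toSubset⁺ Joined? x-Joined) , y∈M))

  member : ∀ p x → Σ[ C ∈ 𝒞 p ] x ∈𝒞 C
  member p x with x ≟ p
  ... | yes refl = C₀ p , x∈⁅x⁆ p
  ... | no x≢p   = (toSubset Joined? , inj₂ copoint) , ∈-toSubset⁺ Joined? x-Joined
    where open CopointAt x≢p

  -- The PQ-tree of a Robinson space

  module _ {T : Tree n} (isPQTree : IsPQTreeOfSpace T) where

    leaves↭ : leaves T ↭ allFin n
    leaves↭ = proj₂ (proj₁ isPQTree)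

    leaves-complete : ∀ x → X⟨ T ⟩ x
    leaves-complete = ListingOrder.complete leaves↭

    -- The order is the position in the leaf list of `T′`; the tree `T′` itself witnesses its
    -- compatibility.
    equivalent-order : ∀ {T′} → T ~ T′ → Σ[ o ∈ Robinson ] AllPairs (proj₁ o) (leaves T′)
    equivalent-order {T′} T~T′ =
      (_<_ , isStrictTotalOrder ,
        Equivalence.from (proj₂ isPQTree _<_ isStrictTotalOrder) (T′ , T~T′ , sorted)) , sorted
      where open ListingOrder (↭-trans (↭-sym (~-leaves T~T′)) leaves↭)

    abstract
      -- Opaque, as later arguments only use that it is some compatible order.
      leaf-order : Robinson
      leaf-order = proj₁ (equivalent-order ε)

    -- Pulls the equivalent tree listed by the order back to `T`, so that different compatible
    -- orders can be compared on the nodes of one fixed tree.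
    compatible⇒Arranged : ∀ ((_<_ , _) : Robinson) → Arranged _<_ T
    compatible⇒Arranged (_<_ , isTotal , compatible)
      with Equivalence.to (proj₂ isPQTree _<_ isTotal) compatible
    ... | T′ , T~T′ , sorted = ~-Arranged T~T′ (sorted⇒Arranged T′ sorted)

    node-interval : ∀ ((_<_ , _) : Robinson) {α} → NodeOf T α → IsInterval _<_ X⟨ α ⟩
    node-interval o@(_ , isTotal , _) path {y = y} =
      TotalOrder.Arranged⇒interval isTotal (compatible⇒Arranged o) path (leaves-complete y)

    node-Lined : ∀ ((_<_ , _) : Robinson) {l ts} → NodeOf T (node l ts) → Lined _<_ l ts
    node-Lined o path with Arranged-node path (compatible⇒Arranged o)
    ... | node _ lined = lined

    -- Reversing the children of a node exchanges x and y while both stay on the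
    -- same side of z.
    sibling-distance : ∀ {l ts s t x y z} → NodeOf T (node l ts) → s ∈ₗ ts → t ∈ₗ ts →
                       X⟨ s ⟩ x → X⟨ t ⟩ y → ¬ X⟨ s ⟩ y → ¬ X⟨ node l ts ⟩ z → d z x ≈ d z y
    sibling-distance {l} {ts} {z = z} path s∈ t∈ x∈s y∈t y∉s z∉ =
      result (AllPairs-∈ (AllPairs.zip (precedes₁ , precedes₂)) s∈ t∈)
      where
      open Context (context path)
      T′ : Tree n
      T′ = proj₁ (replace (⟶-reverse l))
      o₁ : Σ[ o ∈ Robinson ] AllPairs (proj₁ o) (leaves T)
      o₁ = equivalent-order ε
      o₂ : Σ[ o ∈ Robinson ] AllPairs (proj₁ o) (leaves T′)
      o₂ = equivalent-order (proj₁ (proj₂ (replace (⟶-reverse l))) ◅ ε)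
      _<₁_ _<₂_ : Rel (Fin n) 0ℓ
      _<₁_ = proj₁ (proj₁ o₁)
      _<₂_ = proj₁ (proj₁ o₂)
      sorted₁ : AllPairs _<₁_ (before ++ leaves* ts ++ after)
      sorted₁ = subst (AllPairs _<₁_) leaves-≡ (proj₂ o₁)
      sorted₂ : AllPairs _<₂_ (before ++ leaves* (reverse ts) ++ after)
      sorted₂ = subst (AllPairs _<₂_) (proj₂ (proj₂ (replace (⟶-reverse l)))) (proj₂ o₂)
      precedes₁ : AllPairs (Precedes _<₁_) ts
      precedes₁ = sorted⇒Precedes ts
        (AllPairs-++⁻ˡ (leaves* ts) (proj₂ (AllPairs-++⁻ before sorted₁)))
      precedes₂ : AllPairs (converse (Precedes _<₂_)) ts
      -- The second order sorts `reverse ts`; read along `ts`, the precedences are therefore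
      -- converse.
      precedes₂ = subst (AllPairs _) (reverse-involutive ts) (AllPairs-reverse
        (sorted⇒Precedes (reverse ts)
          (AllPairs-++⁻ˡ (leaves* (reverse ts)) (proj₂ (AllPairs-++⁻ before sorted₂)))))
      ∈-reverse : ∀ {x} → x ∈ₗ leaves* ts → x ∈ₗ leaves* (reverse ts)
      ∈-reverse = ∈-resp-↭ (leaves*-↭ (↭-sym (↭-reverse ts)))
      outside : z ∈ₗ before ⊎ z ∈ₗ after
      outside with ∈-++⁻ before (subst (z ∈ₗ_) leaves-≡ (leaves-complete z))
      ... | inj₁ z∈ = inj₁ z∈
      ... | inj₂ z∈ with ∈-++⁻ (leaves* ts) z∈
      ...   | inj₁ z∈ts = contradiction z∈ts z∉
      ...   | inj₂ z∈as = inj₂ z∈as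
      -- Since `z` keeps its side, each of the two orders yields one of the two inequalities.
      exchanged : ∀ {x y} → x ∈ₗ leaves* ts → y ∈ₗ leaves* ts → x <₁ y → y <₂ x → d z x ≈ d z y
      exchanged {x} {y} x∈ y∈ x<₁y y<₂x with outside
      ... | inj₁ z∈ = antisym
        (proj₁ (proj₂ (proj₂ (proj₁ o₁)) z x y
          (AllPairs-∈-++⁻ before sorted₁ z∈ (∈-++⁺ˡ x∈)) x<₁y))
        (proj₁ (proj₂ (proj₂ (proj₁ o₂)) z y x
          (AllPairs-∈-++⁻ before sorted₂ z∈ (∈-++⁺ˡ (∈-reverse y∈))) y<₂x))
      ... | inj₂ z∈ = Eq.trans (symm z x) (Eq.trans (antisym
        (proj₂ (proj₂ (proj₂ (proj₁ o₂)) y x z y<₂x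
          (AllPairs-∈-++⁻ (leaves* (reverse ts)) (proj₂ (AllPairs-++⁻ before sorted₂))
            (∈-reverse x∈) z∈)))
        (proj₂ (proj₂ (proj₂ (proj₁ o₁)) x y z x<₁y
          (AllPairs-∈-++⁻ (leaves* ts) (proj₂ (AllPairs-++⁻ before sorted₁)) y∈ z∈))))
        (symm y z))
      result : _ ≡ _ ⊎ _ × _ ⊎ _ × _ → _
      result (inj₁ refl)                 = contradiction y∈t y∉s
      result (inj₂ (inj₁ (s<₁t , t<₂s))) =
        exchanged (∈leaves*⁺ s∈ x∈s) (∈leaves*⁺ t∈ y∈t) (s<₁t x∈s y∈t) (t<₂s y∈t x∈s)
      result (inj₂ (inj₂ (t<₁s , s<₂t))) = Eq.sym
        (exchanged (∈leaves*⁺ t∈ y∈t) (∈leaves*⁺ s∈ x∈s) (t<₁s y∈t x∈s) (s<₂t x∈s y∈t))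

    -- Induction settles two points below the same child; `sibling-distance` settles points below
    -- different children.
    node-mmodule : ∀ α → NodeOf T α → IsMmodule X⟨ α ⟩
    node-mmodule = tree-induction at-leaf at-node
      where
      at-leaf : ∀ x → NodeOf T (leaf x) → IsMmodule X⟨ leaf x ⟩
      at-leaf _ _ z x y _ (here refl) (here refl) = Eq.refl

      at-node : ∀ l {ts} → All (λ t → NodeOf T t → IsMmodule X⟨ t ⟩) ts →
                NodeOf T (node l ts) → IsMmodule X⟨ node l ts ⟩
      at-node l {ts} ihs path z x y z∉ x∈ y∈ with ∈leaves*⁻ ts x∈ | ∈leaves*⁻ ts y∈
      ... | s , s∈ , x∈s | t , t∈ , y∈t with y ∈X? s
      ...   | yes y∈s = All.lookup ihs s∈ (path ◅◅ (child s∈ ◅ ε)) z x y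
                          (z∉ ∘ ∈leaves*⁺ s∈) x∈s y∈s
      ...   | no y∉s = sibling-distance path s∈ t∈ x∈s y∈t y∉s z∉

    permuted-order : ∀ {ts us} → NodeOf T (node P ts) → ts ↭ us →
                     Σ[ o ∈ Robinson ] AllPairs (proj₁ o) (leaves* us)
    permuted-order {us = us} path ts↭us =
      o , AllPairs-++⁻ˡ (leaves* us) (proj₂ (AllPairs-++⁻ before
            (subst (AllPairs (proj₁ o)) (proj₂ (proj₂ T′)) (proj₂ sorted))))
      where
      open Context (context path)
      T′ = replace (permute ts↭us)
      sorted = equivalent-order (proj₁ (proj₂ T′) ◅ ε)
      o : Robinson
      o = proj₁ sorted

    first-order : ∀ {ts s} → NodeOf T (node P ts) → s ∈ₗ ts →
                  Σ Robinson λ (_<_ , _) →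
                    (∀ {x y} → X⟨ s ⟩ x → y ∈ₗ leaves* ts → ¬ X⟨ s ⟩ y → x < y)
    first-order {ts} {s} path s∈ with to-front s∈
    ... | us , ts↭ with permuted-order path ts↭
    ...   | o@(_<_ , _) , sorted = o , first
      where
      first : ∀ {x y} → X⟨ s ⟩ x → y ∈ₗ leaves* ts → ¬ X⟨ s ⟩ y → x < y
      first x∈s y∈ y∉s with ∈-++⁻ (leaves s) (∈-resp-↭ (leaves*-↭ ts↭) y∈)
      ... | inj₁ y∈s  = contradiction y∈s y∉s
      ... | inj₂ y∈us = AllPairs-∈-++⁻ (leaves s) sorted x∈s y∈us

    -- The children are permuted so that `s` and `t` come first; `u` is then somewhere behind them.
    middle-order : ∀ {ts s t u x y z} → NodeOf T (node P ts) → s ∈ₗ ts → t ∈ₗ ts → u ∈ₗ ts →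
                   X⟨ s ⟩ x → X⟨ t ⟩ y → X⟨ u ⟩ z → s ≢ t → s ≢ u → t ≢ u →
                   Σ Robinson λ (_<_ , _) → x < y × y < z
    middle-order {s = s} {t} path s∈ t∈ u∈ x∈s y∈t z∈u s≢t s≢u t≢u
      with to-front s∈
    ... | ts₁ , p₁ with to-front (remove-∈ (∈-resp-↭ p₁ t∈) (s≢t ∘ sym))
    ...   | ts₂ , p₂ with permuted-order path (↭-trans p₁ (prep _ p₂))
    ...     | o , sorted with sorted⇒Precedes (s ∷ t ∷ ts₂) sorted
    ...       | (s<t ∷ _) ∷ t<ts₂ ∷ _ =
      o , s<t x∈s y∈t , All.lookup t<ts₂ u∈ts₂ y∈t z∈u
      where
      u∈ts₂ = remove-∈ (∈-resp-↭ p₂ (remove-∈ (∈-resp-↭ p₁ u∈) (s≢u ∘ sym))) (t≢u ∘ sym)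

    -- If z lay beside x or y, or if the node were a Q-node, then reversing M would
    -- not yield an order arranging the tree.
    interval-mmodule-spans :
      ∀ ((_<_ , _) : Robinson) {l ts} → NodeOf T (node l ts) →
      {M : Pred (Fin n) 0ℓ} → Decidable M → IsInterval _<_ M → IsMmodule M →
      ∀ {s x y z} → s ∈ₗ ts → X⟨ s ⟩ x → M x → y ∈ₗ leaves* ts → ¬ X⟨ s ⟩ y → M y →
      z ∈ₗ leaves* ts → ¬ M z → Σ Robinson λ (_<′_ , _) → x <′ z × z <′ y
    interval-mmodule-spans o@(_<_ , isTotal , compatible) {l} {ts} path {M} M? M-interval M-mmodule
                           {s} {x} {y} {z} s∈ x∈s mx y∈ y∉s my z∈ ¬mz
      with ∈leaves*⁻ ts y∈ | ∈leaves*⁻ ts z∈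
    ... | t , t∈ , y∈t | u , u∈ , z∈u = spans l path
      where
      open TotalOrder isTotal
      open Reversal M? M-interval
      oᴿ : Robinson
      oᴿ = reversal isTotal compatible M? M-interval M-mmodule
      module Rev = TotalOrder <ᴿ-isStrictTotalOrder

      reversed : ∀ {v w} → M v → M w → v < w → ¬ (v <ᴿ w)
      reversed mv mw v<w v<ᴿw = Rev.asym v<ᴿw (inj₁ (mw , mv , v<w))
      kept : ∀ {w} → M w → w < z → ¬ (z <ᴿ w)
      kept mw w<z z<ᴿw = Rev.asym z<ᴿw (inj₂ ((λ (_ , mz) → ¬mz mz) , w<z))
      kept′ : ∀ {w} → M w → z < w → ¬ (w <ᴿ z)
      kept′ mw z<w w<ᴿz = Rev.asym w<ᴿz (inj₂ ((λ (mz , _) → ¬mz mz) , z<w))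

      -- If `v` and `w` keep their relative order, the reversed pair `x`, `y` contradicts it; if
      -- they are exchanged, the pair `z`, `y`, which reversal keeps, does.
      not-beside : ∀ {v w x y} → Apart _<_ v w → Apart _<ᴿ_ v w →
                   X⟨ v ⟩ x → X⟨ v ⟩ z → X⟨ w ⟩ y → M x → M y → ⊥
      not-beside (inj₁ v<w) (inj₁ v<ᴿw) x∈ z∈ y∈ mx my = reversed mx my (v<w x∈ y∈) (v<ᴿw x∈ y∈)
      not-beside (inj₁ v<w) (inj₂ w<ᴿv) x∈ z∈ y∈ mx my = kept′ my (v<w z∈ y∈) (w<ᴿv y∈ z∈)
      not-beside (inj₂ w<v) (inj₁ v<ᴿw) x∈ z∈ y∈ mx my = kept my (w<v y∈ z∈) (v<ᴿw z∈ y∈)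
      not-beside (inj₂ w<v) (inj₂ w<ᴿv) x∈ z∈ y∈ mx my = reversed my mx (w<v y∈ x∈) (w<ᴿv y∈ x∈)

      s∥t : ∀ ((_<′_ , _) : Robinson) → Apart _<′_ s t
      s∥t o′@(_ , isTotal′ , _) =
        TotalOrder.Lined⇒apart isTotal′ l (node-Lined o′ path) s∈ t∈ y∉s y∈t
      s≢t : s ≢ t
      s≢t refl = y∉s y∈t
      u≢s : u ≢ s
      u≢s refl = not-beside {s} {t} (s∥t o) (s∥t oᴿ) x∈s z∈u y∈t mx my
      u≢t : u ≢ t
      u≢t refl = not-beside {t} {s} (Sum.swap (s∥t o)) (Sum.swap (s∥t oᴿ)) y∈t z∈u x∈s my mx

      same : s ≡ t ⊎ (Precedes _<_ s t × Precedes _<ᴿ_ s t) ⊎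
                     (Precedes _<_ t s × Precedes _<ᴿ_ t s) → ⊥
      same (inj₁ eq)                  = s≢t eq
      same (inj₂ (inj₁ (s<t , s<ᴿt))) = reversed mx my (s<t x∈s y∈t) (s<ᴿt x∈s y∈t)
      same (inj₂ (inj₂ (t<s , t<ᴿs))) = reversed my mx (t<s y∈t x∈s) (t<ᴿs y∈t x∈s)
      opposite : u ≡ s ⊎ (Precedes _<_ u s × Precedes _<ᴿ_ s u) ⊎
                         (Precedes _<_ s u × Precedes _<ᴿ_ u s) → ⊥
      opposite (inj₁ eq)                  = u≢s eq
      opposite (inj₂ (inj₁ (u<s , s<ᴿu))) = kept′ mx (u<s z∈u x∈s) (s<ᴿu x∈s z∈u)
      opposite (inj₂ (inj₂ (s<u , u<ᴿs))) = kept mx (s<u x∈s z∈u) (u<ᴿs z∈u x∈s)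

      spans : ∀ l → NodeOf T (node l ts) → Σ Robinson λ (_<′_ , _) → x <′ z × z <′ y
      spans P path = middle-order path s∈ u∈ t∈ x∈s z∈u y∈t (u≢s ∘ sym) s≢t u≢t
      -- A Q-node shows its children in one of two directions. The same direction in both orders
      -- contradicts the exchange of `x` and `y`; opposite directions contradict that `z` and `x`
      -- keep their order.
      spans Q path with node-Lined o path | node-Lined oᴿ path
      ... | inj₁ ≪ | inj₁ ≪ᴿ = ⊥-elim (same (AllPairs-∈ (AllPairs.zip (≪ , ≪ᴿ)) s∈ t∈))
      ... | inj₁ ≪ | inj₂ ≫ᴿ = ⊥-elim (opposite (AllPairs-∈ (AllPairs.zip (≪ , ≫ᴿ)) u∈ s∈))
      ... | inj₂ ≫ | inj₁ ≪ᴿ =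
        ⊥-elim (opposite (Sum.map₂ Sum.swap (AllPairs-∈ (AllPairs.zip (≫ , ≪ᴿ)) u∈ s∈)))
      ... | inj₂ ≫ | inj₂ ≫ᴿ =
        ⊥-elim (same (Sum.map₂ Sum.swap (AllPairs-∈ (AllPairs.zip (≫ , ≫ᴿ)) s∈ t∈)))

    children-disjoint : ∀ {l ts s t x} → NodeOf T (node l ts) → s ∈ₗ ts → t ∈ₗ ts →
                        X⟨ s ⟩ x → X⟨ t ⟩ x → s ≡ t
    children-disjoint {l} {s = s} {t} path s∈ t∈ x∈s x∈t
      with AllPairs-∈ (Lined⇒Apart l (node-Lined leaf-order path)) s∈ t∈
    ... | inj₁ s≡t        = s≡t
    ... | inj₂ (inj₁ s∥t) = contradiction x∈t (Apart⇒disjoint {s} {t} s∥t x∈s)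
      where open TotalOrder (proj₁ (proj₂ leaf-order))
    ... | inj₂ (inj₂ t∥s) = contradiction x∈s (Apart⇒disjoint {t} {s} t∥s x∈t)
      where open TotalOrder (proj₁ (proj₂ leaf-order))

    lookup-disjoint : ∀ {l ts i j x} → NodeOf T (node l ts) → j ≢ i →
                      X⟨ lookup ts i ⟩ x → ¬ X⟨ lookup ts j ⟩ x
    lookup-disjoint {l} {ts} {i} {j} path j≢i =
      Apart⇒disjoint {lookup ts i} {lookup ts j}
        (AllPairs-lookup Sum.swap (Lined⇒Apart l (node-Lined leaf-order path)) (j≢i ∘ sym))
      where open TotalOrder (proj₁ (proj₂ leaf-order))

    sibling : ∀ {l ts α} → NodeOf T (node l ts) → α ∈ₗ ts →
              ∃[ y ] y ∈ₗ leaves* ts × ¬ X⟨ α ⟩ y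
    sibling {l} {ts} {α} path α∈ = two path (WellFormed-node path (proj₁ (proj₁ isPQTree))) α∈
      where
      two : ∀ {l ts} → NodeOf T (node l ts) → WellFormed (node l ts) → α ∈ₗ ts →
            ∃[ y ] y ∈ₗ leaves* ts × ¬ X⟨ α ⟩ y
      two {ts = _ ∷ []} _ (pnode (s≤s ()) _) _
      two {ts = _ ∷ []} _ (qnode (s≤s ()) _) _
      two {l} {t ∷ u ∷ ts} path w α∈
        with WellFormed⇒nonempty t (All.lookup (WellFormed-children w) (here refl))
           | WellFormed⇒nonempty u (All.lookup (WellFormed-children w) (there (here refl)))
      ... | x , x∈t | y , y∈u with x ∈X? α | y ∈X? α
      ...   | no x∉α  | _       = x , ∈leaves*⁺ {ts = t ∷ u ∷ ts} (here refl) x∈t , x∉α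
      ...   | yes _   | no y∉α  = y , ∈leaves*⁺ {ts = t ∷ u ∷ ts} (there (here refl)) y∈u , y∉α
      ...   | yes x∈α | yes y∈α with children-disjoint path α∈ (here refl) x∈α x∈t
      ...     | refl = contradiction y∈α
                         (lookup-disjoint {i = suc zero} {zero} path (λ ()) y∈u)

    -- Mmodules crossing a node

    module Crossing {S C : Pred (Fin n) 0ℓ} (S-mmodule : IsMmodule S) (C-mmodule : IsMmodule C)
                    {p c y : Fin n} (p∈S : S p) (p∉C : ¬ C p) (c∈S : S c) (c∈C : C c)
                    (y∉S : ¬ S y) (y∈C : C y) where

      -- Seen from `s`, the point `x` may be moved to `y` within `C`; seen from `y`, the point `s`
      -- may be moved to `p` within `S`. The common value `d p y` is the δ of all that follows.
      crossing-distance : ∀ {s x} → S s → ¬ C s → C x → d s x ≈ d p y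
      crossing-distance {s} {x} s∈S s∉C x∈C =
        Eq.trans (C-mmodule s x y s∉C x∈C y∈C)
          (Eq.trans (symm s y) (Eq.trans (S-mmodule y s p y∉S s∈S p∈S) (symm y p)))

      -- Lower bound: `p` and `c` lie on the same side of `z`, at distance δ from each other, so the
      -- farther one is at least δ away from `z`, and `z` is equidistant from both. Upper bound: the
      -- given point on the side of `z` opposite to `p` cannot be in `S`, hence is in `C` and at
      -- distance δ from `p`, with `z` between them.
      between-distance : ∀ ((_<_ , _) : Robinson) → IsInterval _<_ S →
                         ∀ {z x x′} → ¬ S z → ¬ C z → S x ⊎ C x → S x′ ⊎ C x′ →
                         x < z → z < x′ → d z p ≈ d p y
      between-distance (_<_ , isTotal , compatible) S-interval {z} {x} {x′} z∉S z∉C x∈ x′∈ x<z z<x′ =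
        antisym upper lower
        where
        open TotalOrder isTotal
        pc≈δ : d p c ≈ d p y
        pc≈δ = crossing-distance p∈S p∉C c∈C
        zc≈zp : d z c ≈ d z p
        zc≈zp = S-mmodule z c p z∉S c∈S p∈S
        lower : d p y ≤ᵥ d z p
        lower with compare z p | compare z c | compare c p
        ... | tri≈ _ refl _ | _ | _ = contradiction p∈S z∉S
        ... | _ | tri≈ _ refl _ | _ = contradiction c∈S z∉S
        ... | _ | _ | tri≈ _ refl _ = contradiction c∈C p∉C
        ... | tri< z<p _ _ | tri> _ _ c<z | _ = contradiction (S-interval c∈S p∈S c<z z<p) z∉S
        ... | tri> _ _ p<z | tri< z<c _ _ | _ = contradiction (S-interval p∈S c∈S p<z z<c) z∉S
        ... | tri< z<p _ _ | tri< z<c _ _ | tri< c<p _ _ =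
          ≤-respˡ-≈ (Eq.trans (symm c p) pc≈δ) (proj₂ (compatible z c p z<c c<p))
        ... | tri< z<p _ _ | tri< z<c _ _ | tri> _ _ p<c =
          ≤-respˡ-≈ pc≈δ (≤-respʳ-≈ zc≈zp (proj₂ (compatible z p c z<p p<c)))
        ... | tri> _ _ p<z | tri> _ _ c<z | tri< c<p _ _ =
          ≤-respˡ-≈ (Eq.trans (symm c p) pc≈δ)
            (≤-respʳ-≈ (Eq.trans (symm c z) zc≈zp) (proj₁ (compatible c p z c<p p<z)))
        ... | tri> _ _ p<z | tri> _ _ c<z | tri> _ _ p<c =
          ≤-respˡ-≈ pc≈δ (≤-respʳ-≈ (symm p z) (proj₁ (compatible p c z p<c c<z)))
        upper : d z p ≤ᵥ d p y
        upper with compare z p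
        ... | tri≈ _ refl _ = contradiction p∈S z∉S
        ... | tri< z<p _ _ = [ (λ x∈S → contradiction (S-interval x∈S p∈S x<z z<p) z∉S)
          , (λ x∈C → ≤-respʳ-≈ (Eq.trans (symm x p) (crossing-distance p∈S p∉C x∈C))
                       (proj₂ (compatible x z p x<z z<p))) ]′ x∈
        ... | tri> _ _ p<z = [ (λ x′∈S → contradiction (S-interval p∈S x′∈S p<z z<x′) z∉S)
          , (λ x′∈C → ≤-respˡ-≈ (symm p z) (≤-respʳ-≈ (crossing-distance p∈S p∉C x′∈C)
                        (proj₁ (compatible p z x′ p<z z<x′)))) ]′ x′∈

    module CrossedNode {l ts α} (path : NodeOf T (node l ts)) (α∈ : α ∈ₗ ts)
                       {C : Pred (Fin n) 0ℓ} (C? : Decidable C) (C-mmodule : IsMmodule C)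
                       {p c y : Fin n} (p∈α : X⟨ α ⟩ p) (p∉C : ¬ C p)
                       (c∈α : X⟨ α ⟩ c) (c∈C : C c) (y∉α : ¬ X⟨ α ⟩ y) (y∈C : C y) where

      α-path : NodeOf T α
      α-path = path ◅◅ (child α∈ ◅ ε)

      α-mmodule : IsMmodule X⟨ α ⟩
      α-mmodule = node-mmodule α α-path

      open Crossing α-mmodule C-mmodule p∈α p∉C c∈α c∈C y∉α y∈C public
      open Hull (proj₁ (proj₂ leaf-order)) (proj₂ (proj₂ leaf-order)) (λ x → (x ∈X? α) ⊎-dec C? x)

      -- If `y` is not below the parent, the mmodules `X⟨ α ⟩`, `C` and the parent transport the
      -- distance along `z p`, `z c`, `z y`, `p y`. Otherwise `z` is between points of the union in
      -- `leaf-order`, or the hull is an interval mmodule omitting `z` and some other order puts `z`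
      -- between `p` and `y`.
      outside-distance : ∀ {z} → z ∈ₗ leaves* ts → ¬ X⟨ α ⟩ z → d z p ≈ d p y
      outside-distance {z} z∈ z∉α with C? z | DecMembership._∈?_ _≟_ y (leaves* ts)
      ... | yes z∈C | _ = Eq.trans (symm z p) (C-mmodule p z y p∉C z∈C y∈C)
      ... | no z∉C | no y∉ =
        Eq.trans (α-mmodule z p c z∉α p∈α c∈α) (Eq.trans (C-mmodule z c y z∉C c∈C y∈C)
          (Eq.trans (symm z y) (Eq.trans
            (node-mmodule _ path y z p y∉ z∈ (∈leaves*⁺ α∈ p∈α)) (symm y p))))
      ... | no z∉C | yes y∈ with Hull? z
      ...   | yes ((x , x∈ , inj₁ x<z) , (x′ , x′∈ , inj₁ z<x′)) =
        between-distance leaf-order (node-interval leaf-order α-path) z∉α z∉C x∈ x′∈ x<z z<x′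
      ...   | yes ((x , x∈ , inj₂ refl) , _) = ⊥-elim ([ z∉α , z∉C ]′ x∈)
      ...   | yes (_ , (x′ , x′∈ , inj₂ refl)) = ⊥-elim ([ z∉α , z∉C ]′ x′∈)
      ...   | no z∉H =
        let (o′ , p<z , z<y) = interval-mmodule-spans leaf-order path Hull? Hull-interval
              (Hull-mmodule (∪-mmodule α-mmodule C-mmodule c∈α c∈C))
              α∈ p∈α (⊆Hull (inj₁ p∈α)) y∈ y∉α (⊆Hull (inj₂ y∈C)) z∈ z∉H
        in between-distance o′ (node-interval o′ α-path) z∉α z∉C (inj₁ p∈α) (inj₂ y∈C) p<z z<y

      outside-distance′ : ∀ {z s} → z ∈ₗ leaves* ts → ¬ X⟨ α ⟩ z → X⟨ α ⟩ s → d z s ≈ d p y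
      outside-distance′ {z} {s} z∈ z∉α s∈α =
        Eq.trans (α-mmodule z s p z∉α s∈α p∈α) (outside-distance z∈ z∉α)

    -- If X⟨ α ⟩ splits into K and L at distance δ, put it before its siblings and
    -- cut it behind the last a ∈ K before some c ∈ L.  What follows a below the
    -- parent is an mmodule whose reversal moves the siblings between a and c.
    module PNodeParent {ts α} (path : NodeOf T (node P ts)) (α∈ : α ∈ₗ ts) {_<_ : Rel (Fin n) 0ℓ}
                       (isTotal : IsTotalOrder _<_) (compatible : Compatible _<_)
                       (first : ∀ {x y} → X⟨ α ⟩ x → y ∈ₗ leaves* ts → ¬ X⟨ α ⟩ y → x < y)
                       {δ : Value}
                       (outside : ∀ {z s} → z ∈ₗ leaves* ts → ¬ X⟨ α ⟩ z → X⟨ α ⟩ s → d z s ≈ δ)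
                       {y : Fin n} (y∈ : y ∈ₗ leaves* ts) (y∉α : ¬ X⟨ α ⟩ y)
                       where

      open TotalOrder isTotal

      module Cut {K L : Pred (Fin n) 0ℓ}
                 (covers : ∀ {s} → X⟨ α ⟩ s → K s ⊎ L s)
                 (cross : ∀ {s s′} → X⟨ α ⟩ s → X⟨ α ⟩ s′ → K s → L s′ → d s s′ ≈ δ)
                 {a c : Fin n} (a∈ : X⟨ α ⟩ a) (Ka : K a) (a<c : a < c) (c∈ : X⟨ α ⟩ c) (Lc : L c)
                 (a-last : ∀ {x} → X⟨ α ⟩ x → K x → x < c → ¬ (a < x))
                 where

        M : Pred (Fin n) 0ℓ
        M x = x ∈ₗ leaves* ts × a < x
        M? : Decidable M
        M? x = DecMembership._∈?_ _≟_ x (leaves* ts) ×-dec (a <? x)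
        M-interval : IsInterval _<_ M
        M-interval (x∈ , a<x) (z∈ , _) x<y y<z =
          node-interval (_<_ , isTotal , compatible) path x∈ z∈ x<y y<z , <-trans a<x x<y
        -- The sibling point `y` comes after all of `X⟨ α ⟩` and is at distance δ from it.
        upper : ∀ {s s′} → X⟨ α ⟩ s → X⟨ α ⟩ s′ → s < s′ → d s s′ ≤ᵥ δ
        upper {s} {s′} s∈ s′∈ s<s′ =
          ≤-respʳ-≈ (Eq.trans (symm s y) (outside y∈ y∉α s∈))
            (proj₁ (compatible s s′ y s<s′ (first s′∈ y∈ y∉α)))
        -- `K a` and `L x′` give `d a x′` the value δ, and compatibility makes `d z x` at least as
        -- large; the four clauses are the possible coincidences `z ≡ a` and `x′ ≡ x`.
        lower : ∀ {z x x′} → z ≡ a ⊎ z < a → X⟨ α ⟩ x′ → L x′ → a < x′ → x′ ≡ x ⊎ x′ < x →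
                δ ≤ᵥ d z x
        lower (inj₁ refl) x′∈ Lx′ a<x′ (inj₁ refl) = ≤ᵥ-reflexive (Eq.sym (cross a∈ x′∈ Ka Lx′))
        lower (inj₁ refl) x′∈ Lx′ a<x′ (inj₂ x′<x) =
          ≤-respˡ-≈ (cross a∈ x′∈ Ka Lx′) (proj₁ (compatible _ _ _ a<x′ x′<x))
        lower (inj₂ z<a) x′∈ Lx′ a<x′ (inj₁ refl) =
          ≤-respˡ-≈ (cross a∈ x′∈ Ka Lx′) (proj₂ (compatible _ _ _ z<a a<x′))
        lower (inj₂ z<a) x′∈ Lx′ a<x′ (inj₂ x′<x) =
          ≤ᵥ-trans (≤-respˡ-≈ (cross a∈ x′∈ Ka Lx′) (proj₂ (compatible _ _ _ z<a a<x′)))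
                   (proj₁ (compatible _ _ _ (<-trans z<a a<x′) x′<x))
        across : ∀ {z x} → X⟨ α ⟩ z → z ≡ a ⊎ z < a → M x → d z x ≈ δ
        across {z} {x} z∈ z≤a (x∈ , a<x) with x ∈X? α
        ... | no x∉α = Eq.trans (symm z x) (outside x∈ x∉α z∈)
        ... | yes x∈α = antisym
          (upper z∈ x∈α ([ (λ { refl → a<x }) , (λ z<a → <-trans z<a a<x) ]′ z≤a))
          (beyond (covers x∈α))
          where
          -- A point of `K` after `a` is not before `c`, by the choice of `a`, so `c` can play the
          -- role of `x′`.
          beyond : K x ⊎ L x → δ ≤ᵥ d z x
          beyond (inj₂ Lx) = lower z≤a x∈α Lx a<x (inj₁ refl)
          beyond (inj₁ Kx) with compare x c
          ... | tri≈ _ refl _ = lower z≤a c∈ Lc a<c (inj₁ refl)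
          ... | tri> _ _ c<x  = lower z≤a c∈ Lc a<c (inj₂ c<x)
          ... | tri< x<c _ _  = contradiction a<x (a-last x∈α Kx x<c)
        M-mmodule : IsMmodule M
        M-mmodule z x x′ z∉M mx mx′ with DecMembership._∈?_ _≟_ z (leaves* ts)
        ... | no z∉ = node-mmodule _ path z x x′ z∉ (proj₁ mx) (proj₁ mx′)
        ... | yes z∈ with z ∈X? α
        ...   | no z∉α  = contradiction (z∈ , first a∈ z∈ z∉α) z∉M
        ...   | yes z∈α = Eq.trans (across z∈α z≤a mx) (Eq.sym (across z∈α z≤a mx′))
          where
          z≤a : z ≡ a ⊎ z < a
          z≤a with compare z a
          ... | tri< z<a _ _ = inj₂ z<a
          ... | tri≈ _ z≡a _ = inj₁ z≡a
          ... | tri> _ _ a<z = contradiction (z∈ , a<z) z∉M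
        oᴿ : Robinson
        oᴿ = reversal isTotal compatible M? M-interval M-mmodule
        a∉M : ¬ (M a × M y)
        a∉M ((_ , a<a) , _) = <-irrefl refl a<a
        c∈M : M c
        c∈M = ∈leaves*⁺ α∈ c∈ , a<c
        y∈M : M y
        y∈M = y∈ , first a∈ y∈ y∉α

        cut-impossible : ⊥
        cut-impossible = y∉α (node-interval oᴿ (path ◅◅ (child α∈ ◅ ε)) a∈ c∈
          (inj₂ (a∉M , first a∈ y∈ y∉α)) (inj₁ (y∈M , c∈M , first c∈ y∈ y∉α)))

      no-cut : ∀ {K L : Pred (Fin n) 0ℓ} → Decidable K →
               (∀ {s} → X⟨ α ⟩ s → K s ⊎ L s) →
               (∀ {s s′} → X⟨ α ⟩ s → X⟨ α ⟩ s′ → K s → L s′ → d s s′ ≈ δ) →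
               ∀ {k c} → X⟨ α ⟩ k → X⟨ α ⟩ c → K k → L c → ¬ (k < c)
      no-cut K? covers cross {c = c} k∈ c∈ Kk Lc k<c =
        let (a , (a∈ , Ka , a<c) , a-max) =
              maximum (record { isStrictTotalOrder = isTotal }) id
                (λ x → (x ∈X? α) ×-dec K? x ×-dec (x <? c)) (k∈ , Kk , k<c)
        in Cut.cut-impossible covers cross a∈ Ka a<c c∈ Lc
             (λ x∈ Kx x<c a<x →
               [ asym a<x , (λ { refl → <-irrefl refl a<x }) ]′ (a-max (x∈ , Kx , x<c)))

      -- `K` is the complement of `C` if `p` comes first, and `C` if `c` does.
      not-separated : ∀ {C : Pred (Fin n) 0ℓ} → Decidable C →
                      (∀ {s s′} → X⟨ α ⟩ s → X⟨ α ⟩ s′ → ¬ C s → C s′ → d s s′ ≈ δ) →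
                      ∀ {p c} → X⟨ α ⟩ p → X⟨ α ⟩ c → ¬ C p → ¬ C c
      not-separated {C} C? cross {p} {c} p∈ c∈ p∉C c∈C with compare p c
      ... | tri< p<c _ _  =
        no-cut (¬? ∘ C?) (λ _ → Sum.swap (Dec.toSum (C? _))) cross p∈ c∈ p∉C c∈C p<c
      ... | tri≈ _ refl _ = p∉C c∈C
      ... | tri> _ _ c<p  = no-cut C? (λ _ → Dec.toSum (C? _))
        (λ s∈ s′∈ Cs ¬Cs′ → Eq.trans (symm _ _) (cross s′∈ s∈ ¬Cs′ Cs)) c∈ p∈ c∈C p∉C c<p

    standard-uncrossed : ∀ {α p c} → NoZeroSplit T p → NodeOf T α → Standard T α →
      {C : Pred (Fin n) 0ℓ} → Decidable C → IsMmodule C →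
      X⟨ α ⟩ p → ¬ C p → X⟨ α ⟩ c → C c → ∀ {y} → C y → X⟨ α ⟩ y
    standard-uncrossed {α} {p} {c} no-zero α-path standard {C} C? C-mmodule p∈α p∉C c∈α c∈C {y} y∈C
      with y ∈X? α | parent α-path
    ... | yes y∈α | _         = y∈α
    ... | no y∉α  | inj₁ refl = contradiction (leaves-complete y) y∉α
    ... | no y∉α  | inj₂ (P , ts , path , α∈) =
      let ((_ , isTotal , compatible) , first) = first-order path α∈
          (z , z∈ , z∉α) = sibling path α∈
      in contradiction c∈C (PNodeParent.not-separated path α∈ isTotal compatible first
           outside-distance′ z∈ z∉α C?
           (λ s∈ _ s∉C s′∈C → crossing-distance s∈ s∉C s′∈C) p∈α c∈α p∉C)
      where
      open CrossedNode path α∈ C? C-mmodule p∈α p∉C c∈α c∈C y∉α y∈C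
        using (outside-distance′; crossing-distance)
    ... | no y∉α  | inj₂ (Q , ts , path , α∈) = ⊥-elim (split-impossible (0# ≈? d p y))
      where
      open CrossedNode path α∈ C? C-mmodule p∈α p∉C c∈α c∈C y∉α y∈C
        using (outside-distance′; crossing-distance)
      -- Stated for every δ equivalent to `d p y`, since `NoZeroSplit` speaks of `0#` itself.
      conical : ∀ {δ} → d p y ≈ δ → ConicalAt δ ts (index α∈)
      conical py≈δ j j≢i s z s∈ z∈ = Eq.trans (symm s z) (Eq.trans
        (outside-distance′ (∈leaves*⁺ {ts = ts} (∈-lookup j) z∈)
          (λ z∈α → lookup-disjoint path j≢i (subst (λ t → X⟨ t ⟩ z) (lookup-index α∈) z∈α) z∈)
          (subst (λ t → X⟨ t ⟩ s) (sym (lookup-index α∈)) s∈)) py≈δ)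
      -- Every pair crossing from the complement of `C` into `C` within `X⟨ α ⟩` is at distance δ,
      -- hence no edge; so `p` and `c` are not connected.
      stuck : ∀ {δ s s′} → d p y ≈ δ → Star (Edge δ X⟨ α ⟩) s s′ → ¬ C s → ¬ C s′
      stuck py≈δ ε s∉C = s∉C
      stuck py≈δ ((s∈ , _ , _ , far) ◅ steps) s∉C =
        stuck py≈δ steps (λ t∈C → far (Eq.trans (crossing-distance s∈ s∉C t∈C) py≈δ))
      splitAt : ∀ {δ} → d p y ≈ δ → SplitAt T δ α
      splitAt py≈δ =
        (ts , index α∈ , path , lookup-index α∈ , conical py≈δ) ,
        (λ connected → stuck py≈δ (connected p c p∈α c∈α) p∉C c∈C)
      split-impossible : Dec (0# ≈ d p y) → ⊥
      split-impossible (yes 0≈δ) = no-zero α (α-path , path-to-leaf α p∈α) (splitAt (Eq.sym 0≈δ))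
      split-impossible (no 0≉δ) =
        standard (d p y , (minimum (d p y) , 0≉δ) , splitAt Eq.refl)

    -- Nodes from interval mmodules; split nodes

    node-containing : ∀ {S : Pred (Fin n) 0ℓ} → Decidable S → IsMmodule S →
                      (∀ ((_<_ , _) : Robinson) → IsInterval _<_ S) → ∀ {p} → S p →
                      ∃[ α ] NodeOf T α × X⟨ α ⟩ ≐ S
    node-containing {S} S? S-mmodule S-interval {p} p∈S =
      tree-induction at-leaf at-node T ε (λ {x} _ → leaves-complete x)
      where
      Located : Tree n → Set
      Located t = NodeOf T t → (∀ {x} → S x → X⟨ t ⟩ x) → ∃[ α ] NodeOf T α × X⟨ α ⟩ ≐ S

      at-leaf : ∀ x → Located (leaf x)
      at-leaf x path S⊆ with S⊆ p∈S
      ... | here refl = leaf x , path , (λ { (here refl) → p∈S }) , S⊆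

      at-node : ∀ l {ts} → All Located ts → Located (node l ts)
      at-node l {ts} ihs path S⊆ with ∈leaves*⁻ ts (S⊆ p∈S)
      ... | s , s∈ , p∈s with any? (λ x → S? x ×-dec ¬? (x ∈X? s))
      ...   | no ∄ = All.lookup ihs s∈ (path ◅◅ (child s∈ ◅ ε)) S⊆s
        where
        S⊆s : ∀ {x} → S x → X⟨ s ⟩ x
        S⊆s {x} x∈S with x ∈X? s
        ... | yes x∈s = x∈s
        ... | no x∉s  = contradiction (x , x∈S , x∉s) ∄
      -- The descent stops where `S` meets two children. A leaf `z` outside `S` would lie between
      -- `p` and `y` in some compatible order, although `S` is an interval in all of them.
      ...   | yes (y , y∈S , y∉s) = node l ts , path , ⊆S , S⊆
        where
        ⊆S : ∀ {z} → z ∈ₗ leaves* ts → S z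
        ⊆S {z} z∈ with S? z
        ... | yes z∈S = z∈S
        ... | no z∉S =
          let (o′ , p<z , z<y) = interval-mmodule-spans leaf-order path S? (S-interval leaf-order)
                                   S-mmodule s∈ p∈s p∈S (S⊆ y∈S) y∉s y∈S z∈ z∉S
          in contradiction (S-interval o′ p∈S y∈S p<z z<y) z∉S

    -- If α is split, then removing from the parent of α the component of p in
    -- G_δ̅(X⟨ α ⟩) leaves an mmodule that contains points on both sides of X⟨ α ⟩.
    module SplitNode {p α} (p∈α : X⟨ α ⟩ p) {δ} (α-split : SplitAt T δ α) where

      βs : List (Tree n)
      βs = proj₁ (proj₁ α-split)
      i : Fin (length βs)
      i = proj₁ (proj₂ (proj₁ α-split))
      path : NodeOf T (node Q βs)
      path = proj₁ (proj₂ (proj₂ (proj₁ α-split)))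
      α≡ : α ≡ lookup βs i
      α≡ = proj₁ (proj₂ (proj₂ (proj₂ (proj₁ α-split))))
      conical : ConicalAt δ βs i
      conical = proj₂ (proj₂ (proj₂ (proj₂ (proj₁ α-split))))
      α∈ : α ∈ₗ βs
      α∈ = subst (_∈ₗ βs) (sym α≡) (∈-lookup i)

      Reached : Pred (Fin n) ℓ₁
      Reached = Star (Edge δ X⟨ α ⟩) p

      Reached⇒∈ : ∀ {x y} → X⟨ α ⟩ x → Star (Edge δ X⟨ α ⟩) x y → X⟨ α ⟩ y
      Reached⇒∈ x∈ ε = x∈
      Reached⇒∈ x∈ ((_ , y∈ , _) ◅ steps) = Reached⇒∈ y∈ steps

      Edge-sym : ∀ {x y} → Edge δ X⟨ α ⟩ x y → Edge δ X⟨ α ⟩ y x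
      Edge-sym (x∈ , y∈ , x≢y , far) =
        y∈ , x∈ , x≢y ∘ sym , λ near → far (Eq.trans (symm _ _) near)

      sibling-distance-δ : ∀ {z x} → X⟨ α ⟩ z → x ∈ₗ leaves* βs → ¬ X⟨ α ⟩ x → d z x ≈ δ
      sibling-distance-δ {z} {x} z∈α x∈ x∉α with ∈leaves*⁻ βs x∈
      ... | t , t∈ , x∈t = conical (index t∈)
        (λ { eq → x∉α (subst (λ u → X⟨ u ⟩ x)
                 (≡-trans (lookup-index t∈) (≡-trans (cong (lookup βs) eq) (sym α≡))) x∈t) })
        z x (subst (λ u → X⟨ u ⟩ z) α≡ z∈α) (subst (λ u → X⟨ u ⟩ x) (lookup-index t∈) x∈t)

      module _ (Reached? : Decidable Reached) where

        Rest : Pred (Fin n) ℓ₁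
        Rest x = x ∈ₗ leaves* βs × ¬ Reached x

        Rest? : Decidable Rest
        Rest? x = DecMembership._∈?_ _≟_ x (leaves* βs) ×-dec ¬? (Reached? x)

        Rest-mmodule : IsMmodule Rest
        Rest-mmodule z x y z∉ (x∈ , ¬Rx) (y∈ , ¬Ry) with DecMembership._∈?_ _≟_ z (leaves* βs)
        ... | no z∉βs = node-mmodule _ path z x y z∉βs x∈ y∈
        ... | yes z∈ with Reached? z
        ...   | no ¬Rz = contradiction (z∈ , ¬Rz) z∉
        ...   | yes Rz = Eq.trans (to-δ x∈ ¬Rx) (Eq.sym (to-δ y∈ ¬Ry))
          where
          -- `z` is reached and `x` is not: inside `X⟨ α ⟩` they are not adjacent, and outside
          -- conicality applies.
          to-δ : ∀ {x} → x ∈ₗ leaves* βs → ¬ Reached x → d z x ≈ δ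
          to-δ {x} x∈ ¬Rx with x ∈X? α | d z x ≈? δ
          ... | _       | yes near = near
          ... | no x∉α  | no _     = sibling-distance-δ (Reached⇒∈ p∈α Rz) x∈ x∉α
          ... | yes x∈α | no far   = contradiction
            (Rz ◅◅ ((Reached⇒∈ p∈α Rz , x∈α , (λ { refl → ¬Rx Rz }) , far) ◅ ε)) ¬Rx

        unreached : ∃[ x ] X⟨ α ⟩ x × ¬ Reached x
        unreached with any? (λ x → (x ∈X? α) ×-dec ¬? (Reached? x))
        ... | yes found = found
        ... | no ∄ = contradiction connected (proj₂ α-split)
          where
          all-reached : ∀ {x} → X⟨ α ⟩ x → Reached x
          all-reached {x} x∈ with Reached? x
          ... | yes Rx = Rx
          ... | no ¬Rx = contradiction (x , x∈ , ¬Rx) ∄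
          connected : Connected δ X⟨ α ⟩
          connected x y x∈ y∈ = Star.reverse Edge-sym (all-reached x∈) ◅◅ all-reached y∈

      -- The copoint of an unreached point of `X⟨ α ⟩` meets `Rest`, hence absorbs it, including
      -- points below the siblings of `α`. As the goal is `⊥`, reachability may be assumed
      -- decidable: double negation commutes with the quantifier over the finite point set.
      not-copoint-union : (∀ {x} → X⟨ α ⟩ x → Σ[ C ∈ 𝒞 p ] x ∈𝒞 C × (∀ {y} → y ∈𝒞 C → X⟨ α ⟩ y)) → ⊥
      not-copoint-union covered =
        sequence (RawMonad.rawApplicative ¬¬-Monad) (λ x → ¬¬-excluded-middle {A = Reached x}) go
        where
        go : ¬ (∀ x → Dec (Reached x))
        go Reached? with unreached Reached?
        ... | x , x∈α , ¬Rx with covered x∈α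
        ...   | (B , inj₁ refl) , x∈B , _ with refl ← x∈⁅y⁆⇒x≡y {x = x} p x∈B = ¬Rx ε
        ...   | (B , inj₂ B-copoint) , x∈B , B⊆α =
          let (y , y∈ , y∉α) = sibling path α∈ in
          y∉α (B⊆α (copoint-absorbs B-copoint (Rest? Reached?) (Rest-mmodule Reached?)
            (λ (_ , ¬Rp) → ¬Rp ε) x∈B (∈leaves*⁺ α∈ x∈α , ¬Rx)
            (y∈ , λ Ry → y∉α (Reached⇒∈ p∈α Ry))))

    -- Universal proximity orders and the two directions

    module Universal {ℓ} {p : Fin n} (no-zero : NoZeroSplit T p)
                     {_≺_ : Rel (𝒞 p) ℓ} (universal : IsUniversal p _≺_) where

      proximity : ∀ ((_<_ , _) : Robinson) → IsProximityOrder p _<_ _≺_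
      proximity (_<_ , isTotal , compatible) = universal _<_ isTotal compatible

      -- These two fields do not mention the compatible order, so any instance supplies them.
      open IsProximityOrder (proximity leaf-order) using (isStrictTotalOrder; C₀-first)
      module ≺ = IsStrictTotalOrder isStrictTotalOrder

      ¬Between : ∀ ((_<_ , _) : Robinson) {B C} → B ≺ C → ∀ {x y} → x ∈𝒞 B → y ∈𝒞 C →
                 ¬ Between _<_ p y x
      ¬Between o B≺C x∈B y∈C = IsProximityOrder.PO2 (proximity o) B≺C _ _ x∈B y∈C

      module _ {α} (α∈Υ : Υ T p α) (standard : Standard T α) where

        α-path : NodeOf T α
        α-path = proj₁ α∈Υ

        p∈α : X⟨ α ⟩ p
        p∈α = node-⊆ (proj₂ α∈Υ) (here refl)

        uncrossed : ∀ (C : 𝒞 p) {c} → c ∈𝒞 C → X⟨ α ⟩ c → ∀ {y} → y ∈𝒞 C → X⟨ α ⟩ y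
        uncrossed (_ , inj₁ refl) _ _ {y} y∈ with refl ← x∈⁅y⁆⇒x≡y {x = y} p y∈ = p∈α
        uncrossed (C , inj₂ (_ , C-mmodule , p∉C , _)) c∈C c∈α y∈C =
          standard-uncrossed no-zero α-path standard (_∈? C) C-mmodule p∈α p∉C c∈α c∈C y∈C

        initial : ∀ {B C} → B ≺ C → ∀ {c} → c ∈𝒞 C → X⟨ α ⟩ c → ∀ {y} → y ∈𝒞 B → X⟨ α ⟩ y
        initial {B} {_ , inj₁ refl} B≺C _ _ _ = contradiction B≺C (C₀-first B)
        initial {B} {C , inj₂ (_ , _ , p∉C , _)} B≺C {c} c∈C c∈α {y} y∈B with y ∈X? α
        ... | yes y∈α = y∈α
        ... | no y∉α  = ⊥-elim impossible
          where
          o : Robinson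
          o = leaf-order
          open TotalOrder (proj₁ (proj₂ o))
          α-interval : IsInterval (proj₁ o) X⟨ α ⟩
          α-interval = node-interval o α-path
          open Reversal (_∈X? α) α-interval
          oᴿ : Robinson
          oᴿ = reversal (proj₁ (proj₂ o)) (proj₂ (proj₂ o)) (_∈X? α) α-interval
                 (node-mmodule α α-path)
          impossible : ⊥
          impossible with compare p c | compare c y | compare p y
          ... | tri≈ _ refl _ | _ | _ = p∉C c∈C
          ... | _ | tri≈ _ refl _ | _ = y∉α c∈α
          ... | _ | _ | tri≈ _ refl _ = y∉α p∈α
          ... | tri< p<c _ _ | tri< c<y _ _ | _ = ¬Between o B≺C y∈B c∈C (inj₁ (p<c , c<y))
          ... | tri> _ _ c<p | tri> _ _ y<c | _ = ¬Between o B≺C y∈B c∈C (inj₂ (y<c , c<p))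
          ... | tri< p<c _ _ | tri> _ _ y<c | tri< p<y _ _ = y∉α (α-interval p∈α c∈α p<y y<c)
          ... | tri> _ _ c<p | tri< c<y _ _ | tri> _ _ y<p = y∉α (α-interval c∈α p∈α c<y y<p)
          -- In the last two cases `p` lies between `c` and `y`. Reversing `X⟨ α ⟩` exchanges `p`
          -- and `c` and keeps `y` on its side, so `c` comes between `p` and `y`.
          ... | tri< p<c _ _ | tri> _ _ y<c | tri> _ _ y<p =
            ¬Between oᴿ B≺C y∈B c∈C (inj₂ (inj₂ (y∉α ∘ proj₁ , y<c) , inj₁ (c∈α , p∈α , p<c)))
          ... | tri> _ _ c<p | tri< c<y _ _ | tri< p<y _ _ =
            ¬Between oᴿ B≺C y∈B c∈C (inj₁ (inj₁ (p∈α , c∈α , c<p) , inj₂ (y∉α ∘ proj₂ , c<y)))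

        -- `C` is the `≺`-last member meeting `X⟨ α ⟩`: `uncrossed` puts `C` itself inside the node,
        -- and `initial` everything before it.
        standard⇒frontier : ∃[ C ] Frontier _≺_ C × X⟨ α ⟩ ≐ [C₀, C ]⟨ _≺_ ⟩
        standard⇒frontier
          with maximum (record { isStrictTotalOrder = isStrictTotalOrder })
                 (proj₁ ∘ member p) (_∈X? α) p∈α
        ... | m , m∈α , m-max =
          C , IsMmodule-resp-≐ α≐ (node-mmodule α α-path) , α≐
          where
          C : 𝒞 p
          C = proj₁ (member p m)
          α≐ : X⟨ α ⟩ ≐ [C₀, C ]⟨ _≺_ ⟩
          α≐ = (λ {x} x∈α → proj₁ (member p x) , m-max x∈α , proj₂ (member p x)) ,
               λ { (B , inj₁ B≺C , x∈B)  → initial B≺C (proj₂ (member p m)) m∈α x∈B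
                 ; (B , inj₂ refl , x∈B) → uncrossed C (proj₂ (member p m)) m∈α x∈B }

      module _ {C : 𝒞 p} {S : Subset n} (p∈S : p ∈ S) ([C₀,C]≐S : [C₀, C ]⟨ _≺_ ⟩ ≐ (_∈ S)) where

        -- A point `y` outside `S` has its member after `C`. If `y` were between two points of `S`,
        -- it would also be between `p` and one of them, against PO2.
        initial-interval : ∀ ((_<_ , _) : Robinson) → IsInterval _<_ (_∈ S)
        initial-interval o@(_<_ , isTotal , _) {x} {y} {z} x∈S z∈S x<y y<z with y ∈? S
        ... | yes y∈S = y∈S
        ... | no y∉S  = ⊥-elim (impossible (compare p y))
          where
          open TotalOrder isTotal
          B : 𝒞 p
          B = proj₁ (member p y)
          y∈B : y ∈𝒞 B
          y∈B = proj₂ (member p y)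
          C≺B : C ≺ B
          C≺B with ≺.compare C B
          ... | tri< C≺B _ _ = C≺B
          ... | tri≈ _ C≈B _ = contradiction (proj₁ [C₀,C]≐S (B , inj₂ (sym C≈B) , y∈B)) y∉S
          ... | tri> _ _ B≺C = contradiction (proj₁ [C₀,C]≐S (B , inj₁ B≺C , y∈B)) y∉S
          not-between : ∀ {w} → w ∈ S → ¬ Between _<_ p y w
          not-between w∈S with proj₂ [C₀,C]≐S w∈S
          ... | A , inj₁ A≺C , w∈A = ¬Between o (≺.trans A≺C C≺B) w∈A y∈B
          ... | A , inj₂ A≈C , w∈A = ¬Between o (≺.<-respˡ-≈ {x = C} {A} (sym A≈C) C≺B) w∈A y∈B
          impossible : B.Tri (p < y) (p ≡ y) (y < p) → ⊥
          impossible (tri< p<y _ _)  = not-between z∈S (inj₁ (p<y , y<z))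
          impossible (tri≈ _ refl _) = y∉S p∈S
          impossible (tri> _ _ y<p)  = not-between x∈S (inj₂ (x<y , y<p))

        -- `S` is an mmodule and an interval in every compatible order, which yields the node. It is
        -- also a union of members of `𝒞 p`, which the leaf set of a split node above `p` cannot be.
        frontier⇒standard : Frontier _≺_ C → ∃[ α ] Υ T p α × Standard T α × X⟨ α ⟩ ≐ (_∈ S)
        frontier⇒standard frontier
          with node-containing (_∈? S) (IsMmodule-resp-≐ [C₀,C]≐S frontier) initial-interval p∈S
        ... | α , path , α≐S@(α⊆S , S⊆α) =
          α , (path , path-to-leaf α (S⊆α p∈S)) , standard , α≐S
          where
          standard : Standard T α
          standard (δ , _ , α-split) = SplitNode.not-copoint-union (S⊆α p∈S) α-split covered
            where
            covered : ∀ {x} → X⟨ α ⟩ x → Σ[ B ∈ 𝒞 p ] x ∈𝒞 B × (∀ {y} → y ∈𝒞 B → X⟨ α ⟩ y)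
            covered x∈α with proj₂ [C₀,C]≐S (α⊆S x∈α)
            ... | B , B≼C , x∈B = B , x∈B , λ y∈B → S⊆α (proj₁ [C₀,C]≐S (B , B≼C , y∈B))

theorem7p8 : ∀ {c ℓ₁ ℓ₂ ℓ : Level} (V : Values c ℓ₁ ℓ₂) (n : ℕ) (D : Dissimilarity V n) →
    let open Space D in
    Robinson →
    (T : Tree n) → IsPQTreeOfSpace T →
    (p : Fin n) → NoZeroSplit T p →
    (S : Subset n) → p ∈ S →
    (_≺_ : Rel (𝒞 p) ℓ) → IsUniversal p _≺_ →
    (∃[ α ] Υ T p α × Standard T α × X⟨ α ⟩ ≐ (_∈ S))
    ⇔ (∃[ C ] Frontier _≺_ C × [C₀, C ]⟨ _≺_ ⟩ ≐ (_∈ S))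
theorem7p8 V n D _ T isPQTree p no-zero S p∈S _≺_ universal = mk⇔
  (λ (α , α∈Υ , standard , α⊆S , S⊆α) →
    let (C , frontier , α⊆ , ⊆α) = standard⇒frontier α∈Υ standard in
    C , frontier , α⊆S ∘ ⊆α , α⊆ ∘ S⊆α)
  (λ (C , frontier , [C₀,C]≐S) → frontier⇒standard p∈S [C₀,C]≐S frontier)
  where open Universal D isPQTree no-zero universal
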